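{- There are constants $d_0$ and $c$ such that the following holds. For every integer $d \geq d_0$, there is a $1$-factorisation $\mathcal{M}$ of the $d$-dimensional hypercube $Q_d$ such that, for every $\mathcal{N} \subseteq \mathcal{M}$ with $|\mathcal{N}| \geq c \log_2 d$, the union $\bigcup \mathcal{N}$ (the spanning subgraph of $Q_d$ whose edge set is the union of the perfect matchings in $\mathcal{N}$) is connected. In fact, one can take $d_0 = 3000$ and $c = 45$. In particular, $r(d) = O(\log d)$, where $r(d)$ is the minimal positive integer $r$ such that some $1$-factorisation of $Q_d$ has the property that the union of any $r$ distinct $1$-factors is connected.
   Context: $Q_d$ is the graph on $\{0,1\}^d$ in which two vertices are adjacent if and only if they differ in exactly one coordinate. A $1$-factorisation of a regular graph $G$ is a partition $\mathcal{M} = \{M_1, \dots, M_k\}$ of its edge set into perfect matchings of $G$ (for $Q_d$, $k = d$). -}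

module Defs where

open import Data.Nat using (ℕ)
open import Data.Bool using (Bool)
open import Data.Fin using (Fin)
open import Data.Fin.Subset using (Subset; _∈_)
open import Data.Vec using (Vec; lookup)
open import Data.Product using (Σ; ∃; ∃!; _×_)
open import Relation.Binary.PropositionalEquality using (_≡_; _≢_)
open import Relation.Binary.Construct.Closure.ReflexiveTransitive using (Star)

Vertex : ℕ → Set
Vertex d = Vec Bool d

Adjacent : {d : ℕ} → Vertex d → Vertex d → Set
Adjacent {d} u v =
  Σ (Fin d) λ i → (lookup u i ≢ lookup v i)
                × (∀ (j : Fin d) → j ≢ i → lookup u j ≡ lookup v j)

-- A set of edges, given as a (symmetric) relation on vertices
EdgeSet : ℕ → Set₁
EdgeSet d = Vertex d → Vertex d → Set

record IsPerfectMatching {d : ℕ} (M : EdgeSet d) : Set where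
  field
    edges     : ∀ u v → M u v → Adjacent u v
    symmetric : ∀ u v → M u v → M v u
    unique    : ∀ u → ∃! _≡_ (λ v → M u v)

record IsOneFactorisation {d : ℕ} (M : Fin d → EdgeSet d) : Set where
  field
    matchings : ∀ i → IsPerfectMatching (M i)
    partition : ∀ u v → Adjacent u v → ∃! _≡_ (λ i → M i u v)

UnionEdges : {d : ℕ} → (Fin d → EdgeSet d) → Subset d → EdgeSet d
UnionEdges {d} M N u v = Σ (Fin d) λ i → (i ∈ N) × M i u v

Connected : {d : ℕ} → EdgeSet d → Set
Connected {d} E = ∀ (u v : Vertex d) → Star E u v

{-# OPTIONS --safe #-}
module Submission where

-- Start from the 1-factorisation by directions, and on a sparse set of 4-cycles ("cells") exchange
-- the two directions i, j involved. As the cells are far apart, every coset of the subcube spanned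
-- by N stays connected under the colours N; so it suffices that for all N, x and j ∉ N this coset
-- of x meets a cell {i, j} with i ∈ N, because there the colour i crosses in direction j.
--
-- The cells are located by their weight 4t + O(1) and by a syndrome ∑ x_i v_i ∈ 𝔽₂ⁿ, n = O(log d),
-- where the vectors v_i depend on t modulo q = O(log d); each pair (i, j) has its own code word as
-- syndrome, chosen greedily so that the cells are far apart. A set N of size 45 log d contains
-- O(log d) disjoint pairs (a, b) whose differences v_a + v_b span 𝔽₂ⁿ for at least one residue of t,
-- as a potential (conditional expectation) argument arranges for all N at once. The remaining
-- directions of N bring the weight to that residue, and flips of pairs with x_a ≠ x_b, which do not
-- change the weight, then bring the syndrome to the code word.

open import Defs
import Data.Bool as Bool
open import Data.Bool using (Bool; true; false; not; _∧_; _xor_; if_then_else_)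
open import Data.Bool.Properties using (xor-assoc; xor-comm; xor-same; ¬-not; not-involutive; not-¬; not-injective)
open import Data.Empty using (⊥-elim)
open import Data.Fin using (Fin; zero; suc; toℕ; combine; remQuot)
open import Data.Fin.Properties using (toℕ-injective; any?; remQuot-combine; combine-injective; toℕ-fromℕ<; toℕ<n) renaming (<-cmp to <ᶠ-cmp; _≟_ to _≟ᶠ_; suc-injective to sucᶠ-injective)
open import Data.Fin.Subset using (Subset; ∣_∣; _∈_; _∉_; _-_)
open import Data.Fin.Subset.Properties using (_∈?_; x∈p⇒∣p-x∣<∣p∣; x∈p∧x≢y⇒x∈p-y)
open import Data.List using (List; []; _∷_; _++_; map; length; filter; cartesianProductWith; concatMap; allFin; cartesianProduct)
open import Data.List.Membership.Propositional using (find) renaming (_∈_ to _∈ˡ_; _∉_ to _∉ˡ_)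
open import Data.List.Membership.Propositional.Properties using (∈-cartesianProductWith⁺; ∈-filter⁺; ∈-filter⁻; ∈-map⁺; ∈-map⁻; ∈-concatMap⁺; ∈-allFin; ∈-cartesianProduct⁺; ∈-++⁺ˡ; ∈-++⁺ʳ)
open import Data.List.Properties using (map-++; map-∘; length-filter; length-map; length-++; length-tabulate)
open import Data.List.Relation.Unary.All as All using ([]; _∷_)
open import Data.List.Relation.Unary.All.Properties using () renaming (++⁻ˡ to All-++⁻ˡ; ++⁻ʳ to All-++⁻ʳ)
open import Data.List.Relation.Unary.AllPairs as AllPairs using ([]; _∷_)
open import Data.List.Relation.Unary.Any as Any using (here; there)
open import Data.List.Relation.Unary.Unique.Propositional using (Unique)
open import Data.List.Relation.Unary.Unique.Propositional.Properties using () renaming (map⁺ to unique-map⁺)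
open import Data.Nat using (ℕ; zero; suc; _+_; _*_; _^_; _≤_; _<_; _<ᵇ_; z≤n; s≤s; _≤?_; NonZero; >-nonZero; _<?_; _∸_; s≤s⁻¹; >-nonZero⁻¹; nonZero)
open import Data.Nat.DivMod using (_/_; _%_; _mod_; m≡m%n+[m/n]*n; m%n<n; m<n⇒m%n≡m; [m+n]%n≡m%n)
open import Data.Nat.ListAction using (sum)
open import Data.Nat.ListAction.Properties using (sum-++)
open import Data.Nat.Properties
open import Data.Nat.Tactic.RingSolver using (solve-∀)
import Data.Product as Prod
open import Data.Product using (∃; _×_; _,_; proj₁; proj₂; Σ)
import Data.Sum as Sum
open import Data.Sum using (_⊎_; inj₁; inj₂; [_,_]′)
open import Data.Unit using (⊤; tt)
open import Data.Vec using (Vec; []; _∷_; lookup; replicate; zipWith; head; tail; updateAt; tabulate; here; there)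
open import Data.Vec.Properties using (zipWith-assoc; zipWith-comm; zipWith-identityˡ; updateAt-updateAt; updateAt-cong; updateAt-id; updateAt-commutes; lookup∘updateAt; lookup∘updateAt′; ≡-dec; lookup-zipWith; lookup∘tabulate; lookup⇒[]=)
open import Data.Vec.Relation.Unary.All as VAll using ([]; _∷_) renaming (All to VAll)
open import Data.Vec.Relation.Unary.All.Properties using () renaming (tabulate⁺ to vtabulate⁺)
open import Function using (_∘_; id)
open import Relation.Binary.Construct.Closure.ReflexiveTransitive using (Star; ε; _◅_; _◅◅_)
open import Relation.Binary.Definitions using (tri<; tri≈; tri>)
open import Relation.Binary.PropositionalEquality
open import Relation.Nullary using (¬_; Dec; yes; no)
open import Relation.Nullary.Decidable using (¬?; _×-dec_; _⊎-dec_; map′)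

^-cancel-< : ∀ {a b} → 2 ^ a < 2 ^ b → a < b
^-cancel-< {a} {b} lt = ≰⇒> λ b≤a → <⇒≱ lt (^-monoʳ-≤ 2 b≤a)

^-cancel-≤ : ∀ {a b} → 2 ^ a ≤ 2 ^ b → a ≤ b
^-cancel-≤ {a} {b} le = ≮⇒≥ λ b<a → <⇒≱ (^-monoʳ-< 2 (s≤s (s≤s z≤n)) b<a) le

-- Finite sums

∑ : {A : Set} → List A → (A → ℕ) → ℕ
∑ xs f = sum (map f xs)

module _ {A : Set} where

  ∑-mono : ∀ (xs : List A) {f g : A → ℕ} → (∀ {x} → x ∈ˡ xs → f x ≤ g x) → ∑ xs f ≤ ∑ xs g
  ∑-mono []       f≤g = z≤n
  ∑-mono (x ∷ xs) f≤g = +-mono-≤ (f≤g (here refl)) (∑-mono xs (f≤g ∘ there))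

  ∑-cong : ∀ (xs : List A) {f g : A → ℕ} → (∀ {x} → x ∈ˡ xs → f x ≡ g x) → ∑ xs f ≡ ∑ xs g
  ∑-cong []       f≡g = refl
  ∑-cong (x ∷ xs) f≡g = cong₂ _+_ (f≡g (here refl)) (∑-cong xs (f≡g ∘ there))

  ∑-+ : ∀ (xs : List A) (f g : A → ℕ) → ∑ xs (λ x → f x + g x) ≡ ∑ xs f + ∑ xs g
  ∑-+ []       f g = refl
  ∑-+ (x ∷ xs) f g = trans (cong (f x + g x +_) (∑-+ xs f g)) (interchange (f x) (g x) _ _)
    where
    interchange : ∀ a b c d → a + b + (c + d) ≡ a + c + (b + d)
    interchange = solve-∀

  ∑-*ˡ : ∀ (xs : List A) c (f : A → ℕ) → ∑ xs (λ x → c * f x) ≡ c * ∑ xs f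
  ∑-*ˡ []       c f = sym (*-zeroʳ c)
  ∑-*ˡ (x ∷ xs) c f = trans (cong (c * f x +_) (∑-*ˡ xs c f)) (sym (*-distribˡ-+ c (f x) _))

  ∑-const : ∀ (xs : List A) c → ∑ xs (λ _ → c) ≡ length xs * c
  ∑-const []       c = refl
  ∑-const (x ∷ xs) c = cong (c +_) (∑-const xs c)

  ∑-++ : ∀ (xs ys : List A) (f : A → ℕ) → ∑ (xs ++ ys) f ≡ ∑ xs f + ∑ ys f
  ∑-++ xs ys f = trans (cong sum (map-++ f xs ys)) (sum-++ (map f xs) (map f ys))

  ∑-member : ∀ {xs : List A} {x} (f : A → ℕ) → x ∈ˡ xs → f x ≤ ∑ xs f
  ∑-member f (here refl) = m≤m+n _ _
  ∑-member f (there x∈)  = ≤-trans (∑-member f x∈) (m≤n+m _ _)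

  -- Averaging: were every term above `c`, the sum would be at least `length xs * suc c`.
  ∑-witness : ∀ (xs : List A) (f : A → ℕ) c → ∑ xs f < length xs * suc c → ∃ λ x → f x ≤ c
  ∑-witness (x ∷ xs) f c lt with f x ≤? c
  ... | yes fx≤c = x , fx≤c
  ... | no  fx≰c = ∑-witness xs f c
                     (+-cancelˡ-< (suc c) _ _ (≤-<-trans (+-monoˡ-≤ _ (≰⇒> fx≰c)) lt))

∑-comm : ∀ {A B : Set} (xs : List A) (ys : List B) (f : A → B → ℕ) →
         ∑ xs (λ x → ∑ ys (f x)) ≡ ∑ ys (λ y → ∑ xs (λ x → f x y))
∑-comm []       ys f = sym (trans (∑-const ys 0) (*-zeroʳ (length ys)))
∑-comm (x ∷ xs) ys f = trans (cong (∑ ys (f x) +_) (∑-comm xs ys f))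
                             (sym (∑-+ ys (f x) (λ y → ∑ xs (λ x → f x y))))

∑-product : ∀ {A B C : Set} (_⊗_ : A → B → C) (xs : List A) (ys : List B) (f : C → ℕ) →
            ∑ (cartesianProductWith _⊗_ xs ys) f ≡ ∑ xs (λ x → ∑ ys (λ y → f (x ⊗ y)))
∑-product _⊗_ []       ys f = refl
∑-product _⊗_ (x ∷ xs) ys f =
  trans (∑-++ (map (x ⊗_) ys) _ f)
        (cong₂ _+_ (cong sum (sym (map-∘ ys))) (∑-product _⊗_ xs ys f))

words : {A : Set} → List A → ∀ n → List (Vec A n)
words xs zero    = [] ∷ []
words xs (suc n) = cartesianProductWith _∷_ xs (words xs n)

∈-words : ∀ {A : Set} {xs : List A} → (∀ x → x ∈ˡ xs) → ∀ {n} (v : Vec A n) → v ∈ˡ words xs n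
∈-words all []      = here refl
∈-words all (x ∷ v) = ∈-cartesianProductWith⁺ _∷_ (all x) (∈-words all v)

length-product : ∀ {A B C : Set} (_⊗_ : A → B → C) (xs : List A) (ys : List B) →
                 length (cartesianProductWith _⊗_ xs ys) ≡ length xs * length ys
length-product _⊗_ []       ys = refl
length-product _⊗_ (x ∷ xs) ys = trans (length-++ (map (x ⊗_) ys))
                                       (cong₂ _+_ (length-map (x ⊗_) ys) (length-product _⊗_ xs ys))

length-words : ∀ {A : Set} (xs : List A) n → length (words xs n) ≡ length xs ^ n
length-words xs zero    = refl
length-words xs (suc n) = trans (length-product _∷_ xs (words xs n))
                                (cong (length xs *_) (length-words xs n))

-- Linear algebra over 𝔽₂

𝔽₂^ : ℕ → Set
𝔽₂^ = Vec Bool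

infixl 6 _⊕_
infixr 7 _∙_

_⊕_ : ∀ {n} → 𝔽₂^ n → 𝔽₂^ n → 𝔽₂^ n
_⊕_ = zipWith _xor_

𝟎 : ∀ {n} → 𝔽₂^ n
𝟎 = replicate _ false

_∙_ : ∀ {n} → Bool → 𝔽₂^ n → 𝔽₂^ n
b ∙ v = if b then v else 𝟎

dot : ∀ {n} → 𝔽₂^ n → 𝔽₂^ n → Bool
dot []      []      = false
dot (a ∷ w) (b ∷ u) = (a ∧ b) xor dot w u

-- A proof points at a coordinate equal to `true`; `∑-dot` recurses to that coordinate.
data NonZeroᵛ : ∀ {n} → 𝔽₂^ n → Set where
  here  : ∀ {n} {w : 𝔽₂^ n} → NonZeroᵛ (true ∷ w)
  there : ∀ {n} {b} {w : 𝔽₂^ n} → NonZeroᵛ w → NonZeroᵛ (b ∷ w)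

nonZeroᵛ? : ∀ {n} (w : 𝔽₂^ n) → Dec (NonZeroᵛ w)
nonZeroᵛ? []          = no λ ()
nonZeroᵛ? (true ∷ w)  = yes here
nonZeroᵛ? (false ∷ w) with nonZeroᵛ? w
... | yes nz = yes (there nz)
... | no ¬nz = no λ { (there nz) → ¬nz nz }

bits : List Bool
bits = true ∷ false ∷ []

∈-bits : ∀ b → b ∈ˡ bits
∈-bits true  = here refl
∈-bits false = there (here refl)

vectors : ∀ n → List (𝔽₂^ n)
vectors = words bits

ι : Bool → ℕ
ι true  = 1
ι false = 0

eq : Bool → Bool → ℕ
eq a b = ι (not (a xor b))

eq-refl : ∀ a → eq a a ≡ 1
eq-refl true  = refl
eq-refl false = refl

eq-split : ∀ a c → eq (not a) c + eq a c ≡ 1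
eq-split true  true  = refl
eq-split true  false = refl
eq-split false true  = refl
eq-split false false = refl

-- At the marked coordinate the two values of the bit of `u` give opposite products, so exactly one
-- of them matches `c`. A coordinate in front of it merely shifts the target `c`.
∑-dot : ∀ {n} {w : 𝔽₂^ n} → NonZeroᵛ w → ∀ c → 2 * ∑ (vectors n) (λ u → eq (dot w u) c) ≡ 2 ^ n
∑-dot {suc n} {true ∷ w} here c = cong (2 *_) (begin
  ∑ (vectors (suc n)) (λ u → eq (dot (true ∷ w) u) c)
    ≡⟨ ∑-product _∷_ bits (vectors n) _ ⟩
  S (λ u → eq (not (dot w u)) c) + (S (λ u → eq (dot w u) c) + 0)
    ≡⟨ cong (S (λ u → eq (not (dot w u)) c) +_) (+-identityʳ _) ⟩
  S (λ u → eq (not (dot w u)) c) + S (λ u → eq (dot w u) c)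
    ≡⟨ sym (∑-+ (vectors n) _ _) ⟩
  S (λ u → eq (not (dot w u)) c + eq (dot w u) c)
    ≡⟨ ∑-cong (vectors n) (λ {u} _ → eq-split (dot w u) c) ⟩
  S (λ _ → 1)
    ≡⟨ ∑-const (vectors n) 1 ⟩
  length (vectors n) * 1
    ≡⟨ *-identityʳ _ ⟩
  length (vectors n)
    ≡⟨ length-words bits n ⟩
  2 ^ n ∎)
  where
  open ≡-Reasoning
  S = ∑ (vectors n)
∑-dot {suc n} {b ∷ w} (there nz) c = begin
  2 * ∑ (vectors (suc n)) (λ u → eq (dot (b ∷ w) u) c)
    ≡⟨ cong (2 *_) (∑-product _∷_ bits (vectors n) _) ⟩
  2 * (S (λ u → eq ((b ∧ true) xor dot w u) c) + (S (λ u → eq ((b ∧ false) xor dot w u) c) + 0))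
    ≡⟨ cong (2 *_) (cong₂ _+_ (half (b ∧ true) c) (cong (_+ 0) (half (b ∧ false) c))) ⟩
  2 * (S (λ u → eq (dot w u) ((b ∧ true) xor c)) + (S (λ u → eq (dot w u) ((b ∧ false) xor c)) + 0))
    ≡⟨ *-distribˡ-+ 2 (S (λ u → eq (dot w u) ((b ∧ true) xor c))) _ ⟩
  2 * S (λ u → eq (dot w u) ((b ∧ true) xor c)) + 2 * (S (λ u → eq (dot w u) ((b ∧ false) xor c)) + 0)
    ≡⟨ cong₂ _+_ (∑-dot nz _) (trans (cong (2 *_) (+-identityʳ (S (λ u → eq (dot w u) ((b ∧ false) xor c))))) (∑-dot nz _)) ⟩
  2 ^ n + 2 ^ n
    ≡⟨ cong (2 ^ n +_) (sym (+-identityʳ _)) ⟩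
  2 ^ suc n ∎
  where
  open ≡-Reasoning
  S = ∑ (vectors n)
  eq-shift : ∀ e a c → eq (e xor a) c ≡ eq a (e xor c)
  eq-shift true  true  true  = refl
  eq-shift true  true  false = refl
  eq-shift true  false true  = refl
  eq-shift true  false false = refl
  eq-shift false a     c     = refl
  half : ∀ e c → S (λ u → eq (e xor dot w u) c) ≡ S (λ u → eq (dot w u) (e xor c))
  half e c = ∑-cong (vectors n) (λ {u} _ → eq-shift e (dot w u) c)

-- Hash families with few collisions

dots : ∀ {n q} → Vec (𝔽₂^ n) q → Vec (𝔽₂^ n) q → 𝔽₂^ q
dots = zipWith dot

eqs : ∀ {q} → 𝔽₂^ q → 𝔽₂^ q → ℕ
eqs []      []      = 1
eqs (a ∷ u) (b ∷ v) = eq a b * eqs u v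

eqs-refl : ∀ {q} (u : 𝔽₂^ q) → eqs u u ≡ 1
eqs-refl []      = refl
eqs-refl (a ∷ u) = cong₂ _*_ (eq-refl a) (eqs-refl u)

blocks : ∀ n q → List (Vec (𝔽₂^ n) q)
blocks n = words (vectors n)

-- Under non-zero functionals the hash of a random `u` is uniform: the indicator of `c` is a product
-- over independent coordinates, each contributing a half.
∑-dots : ∀ {n q} (w : Vec (𝔽₂^ n) q) → VAll NonZeroᵛ w → ∀ c →
         2 ^ q * ∑ (blocks n q) (λ u → eqs (dots w u) c) ≡ length (blocks n q)
∑-dots []      []         []      = refl
∑-dots {n} {suc q} (w ∷ ws) (nz ∷ nzs) (c ∷ cs) = begin
  2 ^ suc q * ∑ (blocks n (suc q)) (λ u → eqs (dots (w ∷ ws) u) (c ∷ cs))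
    ≡⟨ cong (2 ^ suc q *_) (∑-product _∷_ (vectors n) (blocks n q) _) ⟩
  2 ^ suc q * ∑ (vectors n) (λ u → ∑ (blocks n q) (λ us → eq (dot w u) c * eqs (dots ws us) cs))
    ≡⟨ cong (2 ^ suc q *_) (∑-cong (vectors n) (λ {u} _ →
         trans (∑-*ˡ (blocks n q) (eq (dot w u) c) _) (*-comm (eq (dot w u) c) _))) ⟩
  2 ^ suc q * ∑ (vectors n) (λ u → R * eq (dot w u) c)
    ≡⟨ cong (2 ^ suc q *_) (∑-*ˡ (vectors n) R _) ⟩
  2 * 2 ^ q * (R * L)
    ≡⟨ regroup (2 ^ q) R L ⟩
  2 * L * (2 ^ q * R)
    ≡⟨ cong₂ _*_ (∑-dot nz c) (∑-dots ws nzs cs) ⟩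
  2 ^ n * length (blocks n q)
    ≡⟨ cong (_* length (blocks n q)) (sym (length-words bits n)) ⟩
  length (vectors n) * length (blocks n q)
    ≡⟨ sym (length-product _∷_ (vectors n) (blocks n q)) ⟩
  length (blocks n (suc q)) ∎
  where
  open ≡-Reasoning
  L = ∑ (vectors n) (λ u → eq (dot w u) c)
  R = ∑ (blocks n q) (λ us → eqs (dots ws us) cs)
  regroup : ∀ p r l → 2 * p * (r * l) ≡ 2 * l * (p * r)
  regroup = solve-∀

matches : ∀ {n q m} → Vec (𝔽₂^ n) q → Vec (𝔽₂^ n) q → Vec (Vec (𝔽₂^ n) q) m → ℕ
matches w u []       = 0
matches w u (v ∷ vs) = eqs (dots w u) (dots w v) + matches w u vs

-- The positions of vs whose w-hash occurs again further to the right.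
recurring : ∀ {n q m} → Vec (𝔽₂^ n) q → Vec (Vec (𝔽₂^ n) q) m → Subset m
recurring w []       = []
recurring w (u ∷ vs) = (0 <ᵇ matches w u vs) ∷ recurring w vs

module Potential (n k : ℕ) where

  q : ℕ
  -- Makes `2 ^ q` equal to 2D³; with at most `D` vectors present, a fresh one collides under a
  -- given `w` with probability at most 1 / 2D².
  q = 3 * k + 1

  D : ℕ
  D = 2 ^ k

  U W : List (Vec (𝔽₂^ n) q)
  U = blocks n q
  W = filter (VAll.all? nonZeroᵛ?) U

  -- An exponential moment: bounding the sum bounds the number of recurring positions for all `w` at
  -- once, and the base `D` gives the factor `k` in `few-recurring`.
  Φ : ∀ {m} → Vec (Vec (𝔽₂^ n) q) m → ℕ
  Φ vs = ∑ W (λ w → D ^ ∣ recurring w vs ∣)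

  -- A new recurring position costs a factor `D`. Bounding its indicator by the number of matches
  -- makes the estimate linear in the matches, hence easy to sum over `u`.
  growth : ∀ {m} w u (vs : Vec (Vec (𝔽₂^ n) q) m) →
           D ^ ∣ recurring w (u ∷ vs) ∣ ≤ D ^ ∣ recurring w vs ∣ * (1 + D * matches w u vs)
  growth w u vs with matches w u vs
  ... | zero  = begin
    D ^ ∣ recurring w vs ∣                   ≡⟨ sym (*-identityʳ _) ⟩
    D ^ ∣ recurring w vs ∣ * 1               ≤⟨ *-monoʳ-≤ (D ^ ∣ recurring w vs ∣) (s≤s z≤n) ⟩
    D ^ ∣ recurring w vs ∣ * (1 + D * 0)    ∎
    where open ≤-Reasoning
  ... | suc r = begin
    D * D ^ ∣ recurring w vs ∣                  ≡⟨ *-comm D _ ⟩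
    D ^ ∣ recurring w vs ∣ * D                  ≤⟨ *-monoʳ-≤ (D ^ ∣ recurring w vs ∣)
                                                       (≤-trans (m≤m*n D (suc r)) (n≤1+n _)) ⟩
    D ^ ∣ recurring w vs ∣ * (1 + D * suc r)    ∎
    where open ≤-Reasoning

  ∑-matches : ∀ {m} w → VAll NonZeroᵛ w → (vs : Vec (Vec (𝔽₂^ n) q) m) →
              2 ^ q * ∑ U (λ u → matches w u vs) ≡ m * length U
  ∑-matches w nz []       = trans (cong (2 ^ q *_) (trans (∑-const U 0) (*-zeroʳ (length U)))) (*-zeroʳ (2 ^ q))
  ∑-matches w nz (v ∷ vs) = trans (cong (2 ^ q *_) (∑-+ U _ _))
    (trans (*-distribˡ-+ (2 ^ q) (∑ U (λ u → eqs (dots w u) (dots w v))) _)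
           (cong₂ _+_ (∑-dots w nz (dots w v)) (∑-matches w nz vs)))

  -- Under each w a fresh vector collides with one of the m present ones with probability at most
  -- m / 2^q, so on average it multiplies Φ by at most 1 + D m / 2^q ≤ 1 + 1 / 2D.
  ∑-Φ : ∀ {m} (vs : Vec (Vec (𝔽₂^ n) q) m) →
        ∑ U (λ u → 2 ^ q * Φ (u ∷ vs)) ≤ length U * (Φ vs * (2 ^ q + D * m))
  ∑-Φ {m} vs = begin
    ∑ U (λ u → 2 ^ q * Φ (u ∷ vs))
      ≡⟨ ∑-*ˡ U (2 ^ q) _ ⟩
    2 ^ q * ∑ U (λ u → ∑ W (λ w → D ^ ∣ recurring w (u ∷ vs) ∣))
      ≡⟨ cong (2 ^ q *_) (∑-comm U W _) ⟩
    2 ^ q * ∑ W (λ w → ∑ U (λ u → D ^ ∣ recurring w (u ∷ vs) ∣))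
      ≤⟨ *-monoʳ-≤ (2 ^ q) (∑-mono W (λ {w} _ → ∑-mono U (λ {u} _ → growth w u vs))) ⟩
    2 ^ q * ∑ W (λ w → ∑ U (λ u → c w * (1 + D * matches w u vs)))
      ≡⟨ sym (∑-*ˡ W (2 ^ q) _) ⟩
    ∑ W (λ w → 2 ^ q * ∑ U (λ u → c w * (1 + D * matches w u vs)))
      ≡⟨ ∑-cong W (λ {w} w∈ → average w (proj₂ (∈-filter⁻ (VAll.all? nonZeroᵛ?) {xs = U} w∈))) ⟩
    ∑ W (λ w → length U * (2 ^ q + D * m) * c w)
      ≡⟨ ∑-*ˡ W (length U * (2 ^ q + D * m)) _ ⟩
    length U * (2 ^ q + D * m) * Φ vs
      ≡⟨ trans (*-assoc (length U) _ (Φ vs)) (cong (length U *_) (*-comm _ (Φ vs))) ⟩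
    length U * (Φ vs * (2 ^ q + D * m)) ∎
    where
    open ≤-Reasoning
    c : Vec (𝔽₂^ n) q → ℕ
    c w = D ^ ∣ recurring w vs ∣
    regroup : ∀ p c l t s → p * (c * (l * 1 + t * s)) ≡ c * (l * p + t * (p * s))
    regroup = solve-∀
    regroup′ : ∀ c l p t m → c * (l * p + t * (m * l)) ≡ l * (p + t * m) * c
    regroup′ = solve-∀
    average : ∀ w → VAll NonZeroᵛ w →
              2 ^ q * ∑ U (λ u → c w * (1 + D * matches w u vs)) ≡ length U * (2 ^ q + D * m) * c w
    average w nz = begin-equality
      2 ^ q * ∑ U (λ u → c w * (1 + D * matches w u vs))
        ≡⟨ cong (2 ^ q *_) (∑-*ˡ U (c w) _) ⟩
      2 ^ q * (c w * ∑ U (λ u → 1 + D * matches w u vs))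
        ≡⟨ cong (λ z → 2 ^ q * (c w * z)) (trans (∑-+ U _ _) (cong₂ _+_ (∑-const U 1) (∑-*ˡ U D _))) ⟩
      2 ^ q * (c w * (length U * 1 + D * ∑ U (λ u → matches w u vs)))
        ≡⟨ regroup (2 ^ q) (c w) (length U) D _ ⟩
      c w * (length U * 2 ^ q + D * (2 ^ q * ∑ U (λ u → matches w u vs)))
        ≡⟨ cong (λ z → c w * (length U * 2 ^ q + D * z)) (∑-matches w nz vs) ⟩
      c w * (length U * 2 ^ q + D * (m * length U))
        ≡⟨ regroup′ (c w) (length U) (2 ^ q) D m ⟩
      length U * (2 ^ q + D * m) * c w ∎

  length-U : length U ≡ (2 ^ n) ^ q
  length-U = trans (length-words (vectors n) q) (cong (_^ q) (length-words bits n))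

  U-positive : 0 < length U
  U-positive = subst (0 <_) (sym length-U) (m^n>0 (2 ^ n) {{m^n≢0 2 n}} q)

  extend : ∀ {m} (vs : Vec (Vec (𝔽₂^ n) q) m) → ∃ λ u → 2 ^ q * Φ (u ∷ vs) ≤ Φ vs * (2 ^ q + D * m)
  extend {m} vs = ∑-witness U (λ u → 2 ^ q * Φ (u ∷ vs)) c
    -- The averaged bound is not strict; passing to `suc c` makes it so, because `U` is non-empty.
    (≤-<-trans (∑-Φ vs) (*-monoʳ-< (length U) {{>-nonZero U-positive}} (n<1+n c)))
    where
    c = Φ vs * (2 ^ q + D * m)

  -- The bound 1 + m/D on the ratio of `Φ vs` to `length W` survives a step, because (1 + m/D)(1 +
  -- 1/2D) ≤ 1 + (m+1)/D as long as m ≤ D.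
  family : ∀ m → m ≤ D → ∃ λ (vs : Vec (Vec (𝔽₂^ n) q) m) → D * Φ vs ≤ length W * (D + m)
  family zero    _     = [] , ≤-reflexive (begin-equality
    D * Φ []              ≡⟨ cong (D *_) (trans (∑-const W 1) (*-identityʳ _)) ⟩
    D * length W          ≡⟨ *-comm D _ ⟩
    length W * D          ≡⟨ cong (length W *_) (sym (+-identityʳ D)) ⟩
    length W * (D + 0)    ∎)
    where open ≤-Reasoning
  family (suc m) 1+m≤D with family m (<⇒≤ 1+m≤D)
  ... | vs , bound with extend vs
  ... | u , step = u ∷ vs , *-cancelˡ-≤ (2 * D * D * D) {{nz}} (begin
    2 * D * D * D * (D * Φ (u ∷ vs))
      ≡⟨ r1 D (Φ (u ∷ vs)) ⟩
    D * (2 * D * D * D * Φ (u ∷ vs))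
      ≡⟨ cong (λ z → D * (z * Φ (u ∷ vs))) (sym 2^q) ⟩
    D * (2 ^ q * Φ (u ∷ vs))
      ≤⟨ *-monoʳ-≤ D step ⟩
    D * (Φ vs * (2 ^ q + D * m))
      ≡⟨ sym (*-assoc D (Φ vs) _) ⟩
    D * Φ vs * (2 ^ q + D * m)
      ≤⟨ *-mono-≤ bound (+-mono-≤ (≤-reflexive 2^q) (*-monoʳ-≤ D (<⇒≤ 1+m≤D))) ⟩
    length W * (D + m) * (2 * D * D * D + D * D)
      ≡⟨ r2 (length W) D m ⟩
    length W * D * D * (2 * D * (D + m) + (D + m))
      ≤⟨ *-monoʳ-≤ (length W * D * D) (+-monoʳ-≤ (2 * D * (D + m)) (+-monoʳ-≤ D (<⇒≤ 1+m≤D))) ⟩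
    length W * D * D * (2 * D * (D + m) + (D + D))
      ≡⟨ r3 (length W) D m ⟩
    2 * D * D * D * (length W * (D + suc m)) ∎)
    where
    open ≤-Reasoning
    instance
      D≢0 : NonZero D
      D≢0 = m^n≢0 2 k
    nz : NonZero (2 * D * D * D)
    nz = m*n≢0 (2 * D * D) D {{m*n≢0 (2 * D) D {{m*n≢0 2 D}}}}
    r1 : ∀ D p → 2 * D * D * D * (D * p) ≡ D * (2 * D * D * D * p)
    r1 = solve-∀
    r2 : ∀ l D m → l * (D + m) * (2 * D * D * D + D * D) ≡ l * D * D * (2 * D * (D + m) + (D + m))
    r2 = solve-∀
    r3 : ∀ l D m → l * D * D * (2 * D * (D + m) + (D + D)) ≡ 2 * D * D * D * (l * (D + suc m))
    r3 = solve-∀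
    cube : ∀ D → D * (D * (D * 1)) * 2 ≡ 2 * D * D * D
    cube = solve-∀
    2^q : 2 ^ q ≡ 2 * D * D * D
    2^q = trans (^-distribˡ-+-* 2 (3 * k) 1)
            (trans (cong (_* 2) (trans (cong (2 ^_) (*-comm 3 k)) (sym (^-*-assoc 2 k 3)))) (cube D))

-- Each `w` contributes a single term of `Φ vs`, and `Φ vs` is at most twice the number of all
-- tuples; the claim compares exponents of 2.
few-recurring : ∀ n k d → d ≤ 2 ^ k →
  ∃ λ (vs : Vec (Vec (𝔽₂^ n) (3 * k + 1)) d) →
    ∀ w → VAll NonZeroᵛ w → k * ∣ recurring w vs ∣ ≤ n * (3 * k + 1) + 1
few-recurring n k d d≤D with Potential.family n k d d≤D
... | vs , bound = vs , λ w nz → ^-cancel-≤ (begin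
  2 ^ (k * ∣ recurring w vs ∣)
    ≡⟨ sym (^-*-assoc 2 k _) ⟩
  D ^ ∣ recurring w vs ∣
    ≤⟨ ∑-member (λ w → D ^ ∣ recurring w vs ∣)
         (∈-filter⁺ (VAll.all? nonZeroᵛ?) (∈-words (∈-words ∈-bits) w) nz) ⟩
  Φ vs
    ≤⟨ *-cancelˡ-≤ D {{m^n≢0 2 k}} (begin
         D * Φ vs               ≤⟨ bound ⟩
         length W * (D + d)     ≤⟨ *-mono-≤ (length-filter (VAll.all? nonZeroᵛ?) U) (+-monoʳ-≤ D d≤D) ⟩
         length U * (D + D)     ≡⟨ double (length U) D ⟩
         D * (length U * 2)     ∎) ⟩
  length U * 2
    ≡⟨ cong (_* 2) (trans length-U (^-*-assoc 2 n q)) ⟩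
  2 ^ (n * q) * 2
    ≡⟨ sym (^-distribˡ-+-* 2 (n * q) 1) ⟩
  2 ^ (n * q + 1) ∎)
  where
  open Potential n k
  open ≤-Reasoning
  double : ∀ u l → u * (l + l) ≡ l * (u * 2)
  double = solve-∀

-- Annihilators and spanning sets over 𝔽₂

⊕-assoc : ∀ {n} (u v w : 𝔽₂^ n) → (u ⊕ v) ⊕ w ≡ u ⊕ (v ⊕ w)
⊕-assoc = zipWith-assoc xor-assoc

⊕-comm : ∀ {n} (u v : 𝔽₂^ n) → u ⊕ v ≡ v ⊕ u
⊕-comm = zipWith-comm xor-comm

⊕-identityˡ : ∀ {n} (u : 𝔽₂^ n) → 𝟎 ⊕ u ≡ u
⊕-identityˡ = zipWith-identityˡ (λ _ → refl)

⊕-identityʳ : ∀ {n} (u : 𝔽₂^ n) → u ⊕ 𝟎 ≡ u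
⊕-identityʳ u = trans (⊕-comm u 𝟎) (⊕-identityˡ u)

⊕-self : ∀ {n} (u : 𝔽₂^ n) → u ⊕ u ≡ 𝟎
⊕-self []      = refl
⊕-self (b ∷ u) = cong₂ _∷_ (xor-same b) (⊕-self u)

⊕-cancel : ∀ {n} (u v : 𝔽₂^ n) → (u ⊕ v) ⊕ v ≡ u
⊕-cancel u v = trans (⊕-assoc u v v) (trans (cong (u ⊕_) (⊕-self v)) (⊕-identityʳ u))

dot-⊕ : ∀ {n} (w u v : 𝔽₂^ n) → dot w (u ⊕ v) ≡ dot w u xor dot w v
dot-⊕ []      []      []      = refl
dot-⊕ (a ∷ w) (b ∷ u) (c ∷ v) = trans (cong ((a ∧ (b xor c)) xor_) (dot-⊕ w u v)) (step a b c (dot w u) (dot w v))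
  where
  mid : ∀ c x y → c xor (x xor y) ≡ x xor (c xor y)
  mid false x     y = refl
  mid true  false y = refl
  mid true  true  y = refl
  step : ∀ a b c x y → (a ∧ (b xor c)) xor (x xor y) ≡ ((a ∧ b) xor x) xor ((a ∧ c) xor y)
  step false b c x y = refl
  step true  b c x y = trans (xor-assoc b c (x xor y))
                             (trans (cong (b xor_) (mid c x y)) (sym (xor-assoc b x (c xor y))))

dot-𝟎ˡ : ∀ {n} (u : 𝔽₂^ n) → dot 𝟎 u ≡ false
dot-𝟎ˡ []      = refl
dot-𝟎ˡ (b ∷ u) = dot-𝟎ˡ u

dot-𝟎ʳ : ∀ {n} (w : 𝔽₂^ n) → dot w 𝟎 ≡ false
dot-𝟎ʳ []          = refl
dot-𝟎ʳ (false ∷ w) = dot-𝟎ʳ w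
dot-𝟎ʳ (true ∷ w)  = dot-𝟎ʳ w

-- Every subset closed under the translations by us is empty or everything; this is how the
-- spanning property is used, with the subset of syndromes reachable by flips.
Spanning : ∀ {n} → List (𝔽₂^ n) → Set₁
Spanning {n} us = (P : 𝔽₂^ n → Set) → (∀ s {u} → u ∈ˡ us → P s → P (s ⊕ u)) → ∀ s s′ → P s → P s′

-- Gaussian elimination on the first coordinate. If no vector has leading bit `true`, that
-- coordinate functional annihilates `us`; otherwise a pivot clears the leading bits and the
-- recursion treats the reduced tails.
annihilated-or-spanning : ∀ {n} (us : List (𝔽₂^ n)) →
  (∃ λ w → NonZeroᵛ w × (∀ {u} → u ∈ˡ us → dot w u ≡ false)) ⊎ Spanning us
annihilated-or-spanning {zero}  us = inj₂ λ { P _ [] [] p → p }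
annihilated-or-spanning {suc n} us with Any.any? (λ u → head u Bool.≟ true) us
... | no ¬pivot = inj₁ (true ∷ 𝟎 , here , λ {u} u∈ → annihilates u (λ h → ¬pivot (Any.map (λ { refl → h }) u∈)))
  where
  annihilates : ∀ u → ¬ head u ≡ true → dot (true ∷ 𝟎) u ≡ false
  annihilates (true  ∷ u) ¬h = ⊥-elim (¬h refl)
  annihilates (false ∷ u) ¬h = dot-𝟎ˡ u
... | yes pivot with find pivot
... | true ∷ p , p∈ , refl with annihilated-or-spanning (map (λ u → tail u ⊕ head u ∙ p) us)
-- The new first coordinate `dot w p` makes the functional vanish on the pivot, so its value on `u`
-- is that of `w` on the reduced tail.
... | inj₁ (w , nz , ann) = inj₁ (dot w p ∷ w , there nz , λ {u} u∈ → extend u (ann (∈-map⁺ _ u∈)))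
  where
  extend : ∀ u → dot w (tail u ⊕ head u ∙ p) ≡ false → dot (dot w p ∷ w) u ≡ false
  extend (b ∷ u) eq = trans (trans (xor-comm (dot w p ∧ b) (dot w u)) (cong (dot w u xor_) (scaled b)))
                            (trans (sym (dot-⊕ w u (b ∙ p))) eq)
    where
    scaled : ∀ b → dot w p ∧ b ≡ dot w (b ∙ p)
    scaled true  with dot w p
    ... | true  = refl
    ... | false = refl
    scaled false with dot w p
    ... | true  = sym (dot-𝟎ʳ w)
    ... | false = sym (dot-𝟎ʳ w)
-- Points with leading bit `false` are linked through the reduced tails; a translation by the pivot
-- switches the leading bit.
... | inj₂ spans = inj₂ λ P closed → λ
  { (false ∷ s) (false ∷ s′) → along P closed s s′
  ; (false ∷ s) (true  ∷ s′) → lower P closed s′ ∘ along P closed s (s′ ⊕ p)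
  ; (true  ∷ s) (false ∷ s′) → along P closed (s ⊕ p) s′ ∘ closed (true ∷ s) p∈
  ; (true  ∷ s) (true  ∷ s′) → lower P closed s′ ∘ along P closed (s ⊕ p) (s′ ⊕ p) ∘ closed (true ∷ s) p∈
  }
  where
  Closed : (𝔽₂^ (suc n) → Set) → Set
  Closed P = ∀ s {u} → u ∈ˡ us → P s → P (s ⊕ u)

  lower : ∀ P → Closed P → ∀ s → P (false ∷ s ⊕ p) → P (true ∷ s)
  lower P closed s = subst (λ z → P (true ∷ z)) (⊕-cancel s p) ∘ closed (false ∷ s ⊕ p) p∈

  along : ∀ P → Closed P → ∀ s s′ → P (false ∷ s) → P (false ∷ s′)
  along P closed = spans (λ s → P (false ∷ s)) reduced
    where
    -- A reduced tail acts as `u`, followed by the pivot if `u` has leading bit `true`.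
    translate : ∀ s u → u ∈ˡ us → P (false ∷ s) → P (false ∷ s ⊕ (tail u ⊕ head u ∙ p))
    translate s (false ∷ u) u∈ pr = subst (λ z → P (false ∷ s ⊕ z)) (sym (⊕-identityʳ u)) (closed (false ∷ s) u∈ pr)
    translate s (true  ∷ u) u∈ pr = subst (λ z → P (false ∷ z)) (⊕-assoc s u p)
                                      (closed (true ∷ s ⊕ u) p∈ (closed (false ∷ s) u∈ pr))
    reduced : ∀ s {u} → u ∈ˡ map (λ u → tail u ⊕ head u ∙ p) us → P (false ∷ s) → P (false ∷ s ⊕ u)
    reduced s u∈ pr with ∈-map⁻ (λ u → tail u ⊕ head u ∙ p) u∈
    ... | u , u∈us , refl = translate s u u∈us pr

-- Greedy choice of codes

tails : ∀ {n} → Bool → List (𝔽₂^ (suc n)) → List (𝔽₂^ n)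
tails b []              = []
tails b ((c ∷ x) ∷ xs) with b Bool.≟ c
... | yes _ = x ∷ tails b xs
... | no  _ = tails b xs

tails-length : ∀ {n} (xs : List (𝔽₂^ (suc n))) → length (tails true xs) + length (tails false xs) ≡ length xs
tails-length []                 = refl
tails-length ((true  ∷ x) ∷ xs) = cong suc (tails-length xs)
tails-length ((false ∷ x) ∷ xs) = trans (+-suc _ _) (cong suc (tails-length xs))

∈-tails : ∀ {n} b {v : 𝔽₂^ n} xs → (b ∷ v) ∈ˡ xs → v ∈ˡ tails b xs
∈-tails b ((c ∷ x) ∷ xs) v∈ with b Bool.≟ c | v∈
... | yes _   | here refl = here refl
... | yes _   | there v∈′ = there (∈-tails b xs v∈′)
... | no  b≢b | here refl = ⊥-elim (b≢b refl)
... | no  _   | there v∈′ = ∈-tails b xs v∈′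

-- Pigeonhole by bisection: one half of the cube contains fewer than half of `2 ^ n` listed vectors,
-- and the search continues there.
avoiding : ∀ {n} (xs : List (𝔽₂^ n)) → length xs < 2 ^ n → ∃ λ v → v ∉ˡ xs
avoiding {zero}  []       _  = [] , λ ()
avoiding {zero}  (x ∷ xs) (s≤s ())
avoiding {suc n} xs lt with length (tails true xs) <? 2 ^ n | length (tails false xs) <? 2 ^ n
... | yes l | _     = let v , v∉ = avoiding (tails true xs) l in true ∷ v , v∉ ∘ ∈-tails true xs
... | no _  | yes l = let v , v∉ = avoiding (tails false xs) l in false ∷ v , v∉ ∘ ∈-tails false xs
... | no l  | no l′ = ⊥-elim (<⇒≱ lt (begin
  2 ^ n + (2 ^ n + 0)                                      ≡⟨ cong (2 ^ n +_) (+-identityʳ _) ⟩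
  2 ^ n + 2 ^ n                                            ≤⟨ +-mono-≤ (≮⇒≥ l) (≮⇒≥ l′) ⟩
  length (tails true xs) + length (tails false xs)         ≡⟨ tails-length xs ⟩
  length xs                                                ∎))
  where open ≤-Reasoning

length-concatMap : ∀ {A B : Set} (f : A → List B) c → (∀ x → length (f x) ≤ c) →
                   ∀ xs → length (concatMap f xs) ≤ length xs * c
length-concatMap f c bound []       = z≤n
length-concatMap f c bound (x ∷ xs) =
  ≤-trans (≤-reflexive (length-++ (f x))) (+-mono-≤ (bound x) (length-concatMap f c bound xs))

-- Codes are fixed from the largest index down: the code of `zero` is chosen last, avoiding the at
-- most `K` vectors that each later index forbids.
greedy-code : ∀ {n} K m (forbidden : Fin m → Fin m → 𝔽₂^ n → List (𝔽₂^ n)) →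
              (∀ p p′ c → length (forbidden p p′ c) ≤ K) → m * K < 2 ^ n →
              ∃ λ (code : Fin m → 𝔽₂^ n) → ∀ p p′ → toℕ p < toℕ p′ → code p ∉ˡ forbidden p p′ (code p′)
greedy-code K zero    forbidden bound lt = (λ ()) , λ ()
greedy-code {n} K (suc m) forbidden bound lt
  with greedy-code K m (λ p p′ → forbidden (suc p) (suc p′)) (λ p p′ → bound (suc p) (suc p′)) (≤-<-trans (m≤n+m _ K) lt)
... | code , good = extended , separated
  where
  taken : List (𝔽₂^ n)
  taken = concatMap (λ p′ → forbidden zero (suc p′) (code p′)) (allFin m)
  few : length taken < 2 ^ n
  few = ≤-<-trans (length-concatMap _ K (λ p′ → bound zero (suc p′) (code p′)) (allFin m))
          (≤-<-trans (≤-reflexive (cong (_* K) (length-tabulate (id {A = Fin m})))) (≤-<-trans (m≤n+m _ K) lt))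
  extended : Fin (suc m) → 𝔽₂^ n
  extended zero    = proj₁ (avoiding taken few)
  extended (suc p) = code p
  separated : ∀ p p′ → toℕ p < toℕ p′ → extended p ∉ˡ forbidden p p′ (extended p′)
  separated zero    (suc p′) _        c∈ = proj₂ (avoiding taken few)
    (∈-concatMap⁺ (λ p′ → forbidden zero (suc p′) (code p′)) (Any.map (λ { refl → c∈ }) (∈-allFin p′)))
  separated (suc p) (suc p′) (s≤s lt) c∈ = good p p′ lt c∈

-- Exchanging colours on sparse 4-cycles

flip : ∀ {d} → Vertex d → Fin d → Vertex d
flip x i = updateAt x i not

flip-flip : ∀ {d} (x : Vertex d) i → flip (flip x i) i ≡ x
flip-flip x i = trans (updateAt-updateAt i x) (trans (updateAt-cong i not-involutive x) (updateAt-id i x))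

flip-comm : ∀ {d} (x : Vertex d) i j → i ≢ j → flip (flip x i) j ≡ flip (flip x j) i
flip-comm x i j i≢j = sym (updateAt-commutes i j i≢j x)

lookup-flip : ∀ {d} (x : Vertex d) i → lookup (flip x i) i ≡ not (lookup x i)
lookup-flip x i = lookup∘updateAt i x

lookup-flip′ : ∀ {d} (x : Vertex d) {i j} → j ≢ i → lookup (flip x i) j ≡ lookup x j
lookup-flip′ x {i} {j} j≢i = lookup∘updateAt′ j i j≢i x

lookup-ext : ∀ {A : Set} {d} {u v : Vec A d} → (∀ i → lookup u i ≡ lookup v i) → u ≡ v
lookup-ext {u = []}    {[]}    eq = refl
lookup-ext {u = a ∷ u} {b ∷ v} eq = cong₂ _∷_ (eq zero) (lookup-ext (eq ∘ suc))

flip-adjacent : ∀ {d} (u : Vertex d) i → Adjacent u (flip u i)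
flip-adjacent u i = i , (λ eq → not-¬ {lookup u i} refl (trans eq (lookup-flip u i))) ,
                        (λ j j≢i → sym (lookup-flip′ u j≢i))

adjacent-flip : ∀ {d} {u v : Vertex d} → (adj : Adjacent u v) → v ≡ flip u (proj₁ adj)
adjacent-flip {u = u} {v} (i , u≢v , u≡v) = lookup-ext pointwise
  where
  pointwise : ∀ j → lookup v j ≡ lookup (flip u i) j
  pointwise j with j ≟ᶠ i
  ... | yes refl = trans (¬-not (u≢v ∘ sym)) (sym (lookup-flip u j))
  ... | no  j≢i  = trans (sym (u≡v j j≢i)) (sym (lookup-flip′ u j≢i))

flip-injective : ∀ {d} (u : Vertex d) {i j} → flip u i ≡ flip u j → i ≡ j
flip-injective u {i} {j} eq with i ≟ᶠ j
... | yes i≡j = i≡j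
... | no  i≢j = ⊥-elim (not-¬ {lookup u i} refl
                  (trans (sym (lookup-flip′ u i≢j)) (trans (cong (λ v → lookup v i) (sym eq)) (lookup-flip u i))))

-- Membership in the same coset of the subcube with directions `K`. The disjunction supplies
-- evidence of `K` wherever the bits differ, without deciding `K`.
record AgreeOff {d} (K : Fin d → Set) (x y : Vertex d) : Set where
  constructor agreeing
  field
    agree : ∀ b → lookup x b ≡ lookup y b ⊎ K b

open AgreeOff

-- Coordinates are corrected from the front; the corrected prefix is absorbed into the predicate
-- `P`.
flip-closed : ∀ {d} {K : Fin d → Set} (P : Vertex d → Set) →
              (∀ z b → K b → P z → P (flip z b)) →
              ∀ {x y} → AgreeOff K x y → P x → P y
flip-closed P closed {[]}     {[]}     xy p = p
flip-closed P closed {x₀ ∷ x} {y₀ ∷ y} xy p =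
  flip-closed (λ z → P (y₀ ∷ z)) (λ z b → closed (y₀ ∷ z) (suc b)) (agreeing (agree xy ∘ suc)) first
  where
  first : P (y₀ ∷ x)
  first with x₀ Bool.≟ y₀ | agree xy zero
  ... | yes refl  | _         = p
  ... | no  x₀≢y₀ | inj₁ eq   = ⊥-elim (x₀≢y₀ eq)
  ... | no  x₀≢y₀ | inj₂ k    = subst (λ b → P (b ∷ x)) (sym (¬-not (x₀≢y₀ ∘ sym))) (closed (x₀ ∷ x) zero k p)

-- Swapped x i j: at the vertex x the colours i and j have exchanged their directions.
record Swaps (d : ℕ) : Set₁ where
  field
    Swapped        : Vertex d → Fin d → Fin d → Set
    swapped?       : ∀ x i j → Dec (Swapped x i j)
    swapped-sym    : ∀ {x i j} → Swapped x i j → Swapped x j i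
    swapped-flip   : ∀ {x i j} → Swapped x i j → Swapped (flip x i) i j
    swapped-unique : ∀ {x i j k l} → Swapped x i j → Swapped x k l → (i ≡ k × j ≡ l) ⊎ (i ≡ l × j ≡ k)
    -- Sparsity: the detour of `flip-inside` passes through `flip x a`, where colour `i` must not be
    -- exchanged with any `l`.
    swapped-far    : ∀ {x i j l a} → a ≢ i → a ≢ j → Swapped x i j → ¬ Swapped (flip x a) i l

  -- The direction in which colour `i` leaves `x`. As this is an involution, it is also the colour
  -- of direction `i` at `x`.
  partner : Vertex d → Fin d → Fin d
  partner x i with any? (swapped? x i)
  ... | yes (j , _) = j
  ... | no  _       = i

  partner-swapped : ∀ {x i j} → Swapped x i j → partner x i ≡ j
  partner-swapped {x} {i} s with any? (swapped? x i)
  ... | no ¬s = ⊥-elim (¬s (_ , s))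
  ... | yes (j′ , s′) with swapped-unique s′ s
  ...   | inj₁ (_ , eq)   = eq
  ...   | inj₂ (refl , eq) = eq

  partner-pure : ∀ {x i} → (∀ j → ¬ Swapped x i j) → partner x i ≡ i
  partner-pure {x} {i} pure with any? (swapped? x i)
  ... | yes (j , s) = ⊥-elim (pure j s)
  ... | no  _       = refl

  partner-involutive : ∀ x i → partner x (partner x i) ≡ i
  partner-involutive x i with any? (swapped? x i)
  ... | yes (j , s) = partner-swapped (swapped-sym s)
  ... | no  ¬s      = partner-pure (λ j s → ¬s (j , s))

  -- Makes `M i` symmetric: an exchange persists along both of its directions, and one that first
  -- appeared at the far end would pull back to `x`.
  partner-flip : ∀ x i → partner (flip x (partner x i)) i ≡ partner x i
  partner-flip x i with any? (swapped? x i)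
  ... | yes (j , s) = partner-swapped (swapped-sym (swapped-flip (swapped-sym s)))
  ... | no  ¬s      = partner-pure (λ j s → ¬s (j , subst (λ z → Swapped z i j) (flip-flip x i) (swapped-flip s)))

  M : Fin d → EdgeSet d
  M i u v = v ≡ flip u (partner u i)

  M-factorisation : IsOneFactorisation M
  M-factorisation = record
    { matchings = λ i → record
      { edges     = λ { u _ refl → flip-adjacent u (partner u i) }
      ; symmetric = λ { u _ refl → sym (trans (cong (flip (flip u (partner u i))) (partner-flip u i))
                                              (flip-flip u (partner u i))) }
      ; unique    = λ u → flip u (partner u i) , refl , sym
      }
    ; partition = λ u v adj → partner u (proj₁ adj)
      , trans (adjacent-flip adj) (cong (flip u) (sym (partner-involutive u (proj₁ adj))))
      , λ {i} m → trans (cong (partner u) (flip-injective u (trans (sym (adjacent-flip adj)) m)))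
                        (partner-involutive u i)
    }

  module _ (N : Subset d)
           (spare : ∀ i j → ∃ λ a → a ∈ N × a ≢ i × a ≢ j)
           (hits : ∀ x j → j ∉ N → ∃ λ y → ∃ λ i → AgreeOff (_∈ N) x y × i ∈ N × Swapped y i j) where

    private
      _⇝_ : Vertex d → Vertex d → Set
      _⇝_ = Star (UnionEdges M N)

    edge : ∀ {u i} → i ∈ N → u ⇝ flip u (partner u i)
    edge i∈N = (_ , i∈N , refl) ◅ ε

    pure-edge : ∀ {u i} → i ∈ N → partner u i ≡ i → u ⇝ flip u i
    pure-edge {u} i∈N eq = subst (λ c → u ⇝ flip u c) eq (edge i∈N)

    -- Where i is exchanged with j, the edge x — flip x i is replaced by the other three sides of the
    -- square spanned by i and a third direction a, on which the colours a and i are not exchanged.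
    flip-inside : ∀ x i → i ∈ N → x ⇝ flip x i
    flip-inside x i i∈N with any? (swapped? x i)
    ... | no ¬s = pure-edge i∈N (partner-pure (λ j s → ¬s (j , s)))
    ... | yes (j , s) with spare i j
    ... | a , a∈N , a≢i , a≢j =
      pure-edge a∈N (stays s) ◅◅ pure-edge i∈N (partner-pure λ l s′ → swapped-far a≢i a≢j s s′)
      ◅◅ subst₂ _⇝_ (flip-comm x i a (a≢i ∘ sym)) (flip-flip (flip x i) a)
           -- Colour `a` keeps its direction at the fourth corner: `partner-flip` carries this over
           -- from `flip x i`, where `i` and `j` are still exchanged.
           (pure-edge a∈N (subst (λ c → partner (flip (flip x i) c) a ≡ a) (stays (swapped-flip s))
             (trans (partner-flip (flip x i) a) (stays (swapped-flip s)))))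
      where
      stays : ∀ {z} → Swapped z i j → partner z a ≡ a
      stays s = partner-pure λ l s′ → [ (λ e → a≢i (sym (proj₁ e))) , (λ e → a≢j (sym (proj₂ e))) ]′ (swapped-unique s s′)

    inside : ∀ {x y} → AgreeOff (_∈ N) x y → x ⇝ y
    inside {x} xy = flip-closed (x ⇝_) (λ z b b∈N x⇝z → x⇝z ◅◅ flip-inside z b b∈N) xy ε

    -- For `j` outside `N` the walk goes to a cell, crosses in direction `j` with colour `i`, and
    -- returns inside the coset of `flip x j`.
    flip-any : ∀ x j → x ⇝ flip x j
    flip-any x j with j ∈? N
    ... | yes j∈N = flip-inside x j j∈N
    ... | no  j∉N with hits x j j∉N
    ... | y , i , xy , i∈N , s =
      inside xy ◅◅ subst (λ c → y ⇝ flip y c) (partner-swapped s) (edge i∈N) ◅◅ inside (agreeing xy′)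
      where
      xy′ : ∀ b → lookup (flip y j) b ≡ lookup (flip x j) b ⊎ b ∈ N
      xy′ b with agree xy b
      ... | inj₂ b∈N = inj₂ b∈N
      ... | inj₁ eq with b ≟ᶠ j
      ...   | yes refl = inj₁ (trans (lookup-flip y b) (trans (cong not (sym eq)) (sym (lookup-flip x b))))
      ...   | no  b≢j  = inj₁ (trans (lookup-flip′ y b≢j) (trans (sym eq) (sym (lookup-flip′ x b≢j))))

    connected : Connected (UnionEdges M N)
    connected x y = flip-closed {K = λ _ → ⊤} (x ⇝_) (λ z b _ x⇝z → x⇝z ◅◅ flip-any z b) (agreeing λ _ → inj₂ tt) ε

-- Cells located by weight and syndrome

-- No translate of the span of v i, v j by code i j meets, or is adjacent through some v a to,
-- the corresponding set of another pair.
Separated : ∀ {d n} → (Fin d → 𝔽₂^ n) → (Fin d → Fin d → 𝔽₂^ n) → Set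
Separated {d} v code = ∀ i j k l → ¬ (i ≡ k × j ≡ l) → ∀ α β γ δ η (a : Fin d) →
  code i j ⊕ (α ∙ v i ⊕ β ∙ v j) ≢ (code k l ⊕ (γ ∙ v k ⊕ δ ∙ v l)) ⊕ η ∙ v a

-- Five bits and a direction describe at most `32 * d` forbidden translates for each of the `d * d`
-- ordered pairs, so the greedy choice applies.
separated-code : ∀ {d n} (v : Fin d → 𝔽₂^ n) → d * d * (32 * d) < 2 ^ n → ∃ (Separated v)
separated-code {d} {n} v lt = code , separated
  where
  choices : List (Vec Bool 5 × Fin d)
  choices = cartesianProduct (words bits 5) (allFin d)

  translate : (Fin d × Fin d) → (Fin d × Fin d) → 𝔽₂^ n → Vec Bool 5 × Fin d → 𝔽₂^ n
  translate (i , j) (k , l) c (α ∷ β ∷ γ ∷ δ ∷ η ∷ [] , a) =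
    ((c ⊕ (γ ∙ v k ⊕ δ ∙ v l)) ⊕ η ∙ v a) ⊕ (α ∙ v i ⊕ β ∙ v j)

  forbidden : Fin (d * d) → Fin (d * d) → 𝔽₂^ n → List (𝔽₂^ n)
  forbidden p p′ c = map (translate (remQuot d p) (remQuot d p′) c) choices

  bound : ∀ p p′ c → length (forbidden p p′ c) ≤ 32 * d
  bound p p′ c = ≤-reflexive (trans (length-map _ choices)
    (trans (length-product _,_ (words bits 5) (allFin d)) (cong (32 *_) (length-tabulate (id {A = Fin d})))))

  greedy = greedy-code (32 * d) (d * d) forbidden bound lt

  code : Fin d → Fin d → 𝔽₂^ n
  code i j = proj₁ greedy (combine i j)

  ordered : ∀ i j k l → toℕ (combine i j) < toℕ (combine k l) → ∀ α β γ δ η (a : Fin d) →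
            code i j ⊕ (α ∙ v i ⊕ β ∙ v j) ≢ (code k l ⊕ (γ ∙ v k ⊕ δ ∙ v l)) ⊕ η ∙ v a
  ordered i j k l lt α β γ δ η a eq = proj₂ greedy (combine i j) (combine k l) lt
    (subst₂ (λ p p′ → code i j ∈ˡ map (translate p p′ (code k l)) choices)
      (sym (remQuot-combine {d} {d} i j)) (sym (remQuot-combine {d} {d} k l))
      (subst (_∈ˡ map (translate (i , j) (k , l) (code k l)) choices)
        (trans (cong (_⊕ (α ∙ v i ⊕ β ∙ v j)) (sym eq)) (⊕-cancel (code i j) _))
        (∈-map⁺ (translate (i , j) (k , l) (code k l))
          (∈-cartesianProduct⁺ (∈-words ∈-bits (α ∷ β ∷ γ ∷ δ ∷ η ∷ [])) (∈-allFin a)))))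

  separated : Separated v code
  separated i j k l p≢p′ α β γ δ η a eq with <ᶠ-cmp (combine i j) (combine k l)
  ... | tri< lt _ _ = ordered i j k l lt α β γ δ η a eq
  ... | tri≈ _ e _  = p≢p′ (combine-injective i j k l e)
  -- The greedy condition is one-sided; in the opposite order the term `η ∙ v a` is moved across the
  -- equation.
  ... | tri> _ _ gt = ordered k l i j gt γ δ α β η a
                        (trans (sym (⊕-cancel _ (η ∙ v a))) (cong (_⊕ η ∙ v a) (sym eq)))

wt : ∀ {d} → Vertex d → ℕ
wt []      = 0
wt (b ∷ x) = ι b + wt x

syn : ∀ {d n} → (Fin d → 𝔽₂^ n) → Vertex d → 𝔽₂^ n
syn v []      = 𝟎
syn v (b ∷ x) = b ∙ v zero ⊕ syn (v ∘ suc) x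

not-∙ : ∀ {n} b (u : 𝔽₂^ n) → not b ∙ u ≡ b ∙ u ⊕ u
not-∙ true  u = sym (⊕-self u)
not-∙ false u = sym (⊕-identityˡ u)

⊕-swap : ∀ {n} (a b c : 𝔽₂^ n) → (a ⊕ b) ⊕ c ≡ (a ⊕ c) ⊕ b
⊕-swap a b c = trans (⊕-assoc a b c) (trans (cong (a ⊕_) (⊕-comm b c)) (sym (⊕-assoc a c b)))

syn-flip : ∀ {d n} (v : Fin d → 𝔽₂^ n) (x : Vertex d) a → syn v (flip x a) ≡ syn v x ⊕ v a
syn-flip v (b ∷ x) zero    = trans (cong (_⊕ syn (v ∘ suc) x) (not-∙ b (v zero))) (⊕-swap _ _ _)
syn-flip v (b ∷ x) (suc a) = trans (cong (b ∙ v zero ⊕_) (syn-flip (v ∘ suc) x a)) (sym (⊕-assoc _ _ _))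

wt-flip : ∀ {d} (x : Vertex d) a → wt (flip x a) + ι (lookup x a) ≡ wt x + ι (not (lookup x a))
wt-flip (b ∷ x) zero    = shuffle (ι (not b)) (wt x) (ι b)
  where
  shuffle : ∀ a b c → a + b + c ≡ c + b + a
  shuffle = solve-∀
wt-flip (b ∷ x) (suc a) = trans (+-assoc (ι b) _ _) (trans (cong (ι b +_) (wt-flip x a)) (sym (+-assoc (ι b) _ _)))

ι≤1 : ∀ b → ι b ≤ 1
ι≤1 true  = s≤s z≤n
ι≤1 false = z≤n

wt-flip-≤ : ∀ {d} (x : Vertex d) a → wt (flip x a) ≤ suc (wt x)
wt-flip-≤ x a = begin
  wt (flip x a)                       ≤⟨ m≤m+n _ _ ⟩
  wt (flip x a) + ι (lookup x a)      ≡⟨ wt-flip x a ⟩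
  wt x + ι (not (lookup x a))         ≤⟨ +-monoʳ-≤ (wt x) (ι≤1 _) ⟩
  wt x + 1                            ≡⟨ +-comm (wt x) 1 ⟩
  suc (wt x)                          ∎
  where open ≤-Reasoning

wt-flip-≢ : ∀ {d} (x : Vertex d) a → wt (flip x a) ≢ wt x
wt-flip-≢ x a eq with lookup x a | +-cancelˡ-≡ (wt x) _ _ (trans (cong (_+ ι (lookup x a)) (sym eq)) (wt-flip x a))
... | true  | ()
... | false | ()

module Cells {d n : ℕ} (v : ℕ → Fin d → 𝔽₂^ n) (code : ℕ → Fin d → Fin d → 𝔽₂^ n)
             (sep : ∀ t → Separated (v t) (code t)) where

  -- x lies on the 4-cycle in directions i and j through a vertex z with z_i = z_j = 0
  -- whose weight is 4t and whose syndrome is c.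
  record OnCycle (t : ℕ) (c : 𝔽₂^ n) (x : Vertex d) (i j : Fin d) : Set where
    constructor onCycle
    field
      weight   : wt x ≡ 4 * t + (ι (lookup x i) + ι (lookup x j))
      syndrome : syn (v t) x ≡ c ⊕ (lookup x i ∙ v t i ⊕ lookup x j ∙ v t j)

  open OnCycle

  onCycle-sym : ∀ {t c x i j} → OnCycle t c x i j → OnCycle t c x j i
  onCycle-sym {t} {c} {x} {i} {j} (onCycle w s) = onCycle
    (trans w (cong (4 * t +_) (+-comm (ι (lookup x i)) _)))
    (trans s (cong (c ⊕_) (⊕-comm (lookup x i ∙ v t i) _)))

  -- Flipping `i` changes both sides of the weight equation by the same amount, and both sides of
  -- the syndrome equation by `v t i`.
  onCycle-flip : ∀ {t c x i j} → i ≢ j → OnCycle t c x i j → OnCycle t c (flip x i) i j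
  onCycle-flip {t} {c} {x} {i} {j} i≢j (onCycle w s) = onCycle weight′ syndrome′
    where
    open ≡-Reasoning
    shuffle : ∀ p b c n → p + (b + c) + n ≡ p + (n + c) + b
    shuffle = solve-∀
    weight′ : wt (flip x i) ≡ 4 * t + (ι (lookup (flip x i) i) + ι (lookup (flip x i) j))
    weight′ rewrite lookup-flip x i | lookup-flip′ x (i≢j ∘ sym) = +-cancelʳ-≡ (ι (lookup x i)) _ _
      (trans (wt-flip x i) (trans (cong (_+ ι (not (lookup x i))) w) (shuffle (4 * t) (ι (lookup x i)) _ _)))
    syndrome′ : syn (v t) (flip x i) ≡ c ⊕ (lookup (flip x i) i ∙ v t i ⊕ lookup (flip x i) j ∙ v t j)
    syndrome′ rewrite lookup-flip x i | lookup-flip′ x (i≢j ∘ sym) = begin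
      syn (v t) (flip x i)                            ≡⟨ syn-flip (v t) x i ⟩
      syn (v t) x ⊕ v t i                             ≡⟨ cong (_⊕ v t i) s ⟩
      (c ⊕ (lookup x i ∙ v t i ⊕ _)) ⊕ v t i          ≡⟨ ⊕-assoc c _ _ ⟩
      c ⊕ ((lookup x i ∙ v t i ⊕ _) ⊕ v t i)          ≡⟨ cong (c ⊕_) (⊕-swap (lookup x i ∙ v t i) _ _) ⟩
      c ⊕ ((lookup x i ∙ v t i ⊕ v t i) ⊕ _)          ≡⟨ cong (λ z → c ⊕ (z ⊕ _)) (sym (not-∙ (lookup x i) (v t i))) ⟩
      c ⊕ (not (lookup x i) ∙ v t i ⊕ _)              ∎

  Cell : Vertex d → Fin d → Fin d → Set
  Cell x i j = i ≢ j × ∃ λ t → OnCycle t (code t i j) x i j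

  cell? : ∀ x i j → Dec (Cell x i j)
  cell? x i j = ¬? (i ≟ᶠ j) ×-dec map′ (λ { (t , _ , at) → t , at }) bounded (anyUpTo? onCycle? (suc (wt x)))
    where
    onCycle? : ∀ t → Dec (OnCycle t (code t i j) x i j)
    onCycle? t = map′ (λ { (w , s) → onCycle w s }) (λ { (onCycle w s) → w , s }) ((_ ≟ _) ×-dec ≡-dec Bool._≟_ _ _)
    -- Only finitely many `t` have to be tried, since t ≤ 4t ≤ `wt x`.
    bounded : (∃ λ t → OnCycle t (code t i j) x i j) → ∃ λ t → t < suc (wt x) × OnCycle t (code t i j) x i j
    bounded (t , onCycle w s) = t , s≤s (≤-trans (m≤n*m t 4) (≤-trans (m≤m+n (4 * t) _) (≤-reflexive (sym w)))) , onCycle w s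

  -- Distance at most one. A direction is carried even when `η` is `false`, to match the summand
  -- `η ∙ v a` of `Separated`.
  Near : Vertex d → Vertex d → Set
  Near x y = ∃ λ η → ∃ λ a → y ≡ (if η then flip x a else x)

  near-wt : ∀ {x y} → Near x y → wt y ≤ suc (wt x) × wt x ≤ suc (wt y)
  near-wt {x} (true  , a , refl) =
    wt-flip-≤ x a , subst (λ z → wt z ≤ suc (wt (flip x a))) (flip-flip x a) (wt-flip-≤ (flip x a) a)
  near-wt (false , a , refl) = n≤1+n _ , n≤1+n _

  near-syn : ∀ t {x y} (near : Near x y) → syn (v t) y ≡ syn (v t) x ⊕ proj₁ near ∙ v t (proj₁ (proj₂ near))
  near-syn t {x} (true  , a , refl) = syn-flip (v t) x a
  near-syn t {x} (false , a , refl) = sym (⊕-identityʳ _)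

  -- This is why levels are spaced by 4: a cycle of level t has weights from 4t to 4t + 2, so
  -- weights of different levels differ by at least 2.
  level-≤ : ∀ {t t′ m m′} α β γ δ → m ≡ 4 * t + (ι α + ι β) → m′ ≡ 4 * t′ + (ι γ + ι δ) → m ≤ suc m′ → t ≤ t′
  level-≤ {t} {t′} α β γ δ refl refl le with t ≤? t′
  ... | yes t≤t′ = t≤t′
  ... | no  t≰t′ = ⊥-elim (<⇒≱ (begin-strict
    suc (4 * t′ + (ι γ + ι δ))      ≤⟨ s≤s (+-monoʳ-≤ (4 * t′) (+-mono-≤ (ι≤1 γ) (ι≤1 δ))) ⟩
    suc (4 * t′ + 2)                <⟨ ≤-reflexive (next t′) ⟩
    4 * suc t′                      ≤⟨ *-monoʳ-≤ 4 (≰⇒> t≰t′) ⟩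
    4 * t                           ≤⟨ m≤m+n _ _ ⟩
    4 * t + (ι α + ι β)             ∎) le)
    where
    open ≤-Reasoning
    next : ∀ t → suc (suc (4 * t + 2)) ≡ 4 * suc t
    next = solve-∀

  near-level : ∀ {x y i j k l t t′ c c′} → Near x y → OnCycle t c x i j → OnCycle t′ c′ y k l → t ≡ t′
  near-level {x} {y} {i} {j} {k} {l} near (onCycle w _) (onCycle w′ _) = ≤-antisym
    (level-≤ (lookup x i) (lookup x j) (lookup y k) (lookup y l) w w′ (proj₂ (near-wt near)))
    (level-≤ (lookup y k) (lookup y l) (lookup x i) (lookup x j) w′ w (proj₁ (near-wt near)))

  -- Near vertices on cells have equal levels, hence share vectors and codes; for distinct ordered
  -- pairs their syndromes would then be related as `Separated` forbids.
  near-pair : ∀ {x y i j k l} → Near x y → Cell x i j → Cell y k l → i ≡ k × j ≡ l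
  near-pair {x} {y} {i} {j} {k} {l} near (_ , t , at) (_ , t′ , at′) with near-level near at at′
  ... | refl with (i ≟ᶠ k) ×-dec (j ≟ᶠ l)
  ...   | yes same = same
  ...   | no  diff = ⊥-elim (sep t k l i j (λ { (e , e′) → diff (sym e , sym e′) }) _ _ _ _ _ _
                       (trans (sym (syndrome at′)) (trans (near-syn t near) (cong (_⊕ _) (syndrome at)))))

  -- The level and the bits at `i` and `j` would be unchanged, and with them the weight, but every
  -- flip changes the weight.
  cell-flip : ∀ {x i j a} → a ≢ i → a ≢ j → Cell x i j → ¬ Cell (flip x a) i j
  cell-flip {x} {i} {j} {a} a≢i a≢j (_ , t , at) (_ , t′ , at′)
    with near-level {t = t} {t′} (true , a , refl) at at′
  ... | refl = wt-flip-≢ x a (trans (weight at′) (trans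
    (cong₂ (λ b c → 4 * t + (ι b + ι c)) (lookup-flip′ x (a≢i ∘ sym)) (lookup-flip′ x (a≢j ∘ sym)))
    (sym (weight at))))

  swaps : Swaps d
  swaps = record
    { Swapped        = Swapped
    ; swapped?       = λ x i j → cell? x i j ⊎-dec cell? x j i
    ; swapped-sym    = Sum.swap
    ; swapped-flip   = λ { (inj₁ (i≢j , t , at)) → inj₁ (i≢j , t , onCycle-flip i≢j at)
                   ; (inj₂ (j≢i , t , at)) → inj₂ (j≢i , t , onCycle-sym (onCycle-flip (j≢i ∘ sym) (onCycle-sym at))) }
    ; swapped-unique = unique
    ; swapped-far    = far
    }
    where
    Swapped : Vertex d → Fin d → Fin d → Set
    Swapped x i j = Cell x i j ⊎ Cell x j i
    unique : ∀ {x i j k l} → Swapped x i j → Swapped x k l → (i ≡ k × j ≡ l) ⊎ (i ≡ l × j ≡ k)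
    unique {i = i} (inj₁ c) (inj₁ c′) = inj₁ (near-pair (false , i , refl) c c′)
    unique {i = i} (inj₁ c) (inj₂ c′) = inj₂ (near-pair (false , i , refl) c c′)
    unique {i = i} (inj₂ c) (inj₁ c′) = inj₂ (Prod.swap (near-pair (false , i , refl) c c′))
    unique {i = i} (inj₂ c) (inj₂ c′) = inj₁ (Prod.swap (near-pair (false , i , refl) c c′))
    far : ∀ {x i j l a} → a ≢ i → a ≢ j → Swapped x i j → ¬ Swapped (flip x a) i l
    far {a = a} a≢i a≢j (inj₁ c) (inj₁ c′) with near-pair (true , a , refl) c c′
    ... | refl , refl = cell-flip a≢i a≢j c c′
    -- In the mixed cases equality of the two ordered pairs would force `i ≡ j`.
    far {a = a} a≢i a≢j (inj₁ c) (inj₂ c′) = proj₁ c (sym (proj₂ (near-pair (true , a , refl) c c′)))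
    far {a = a} a≢i a≢j (inj₂ c) (inj₁ c′) = proj₁ c (proj₁ (near-pair (true , a , refl) c c′))
    far {a = a} a≢i a≢j (inj₂ c) (inj₂ c′) with near-pair (true , a , refl) c c′
    ... | refl , refl = cell-flip a≢j a≢i c c′

-- Lists of distinct directions

elements : ∀ {n} → Subset n → List (Fin n)
elements []          = []
elements (true  ∷ p) = zero ∷ map suc (elements p)
elements (false ∷ p) = map suc (elements p)

elements-unique : ∀ {n} (p : Subset n) → Unique (elements p)
elements-unique []          = []
elements-unique (true  ∷ p) = All.tabulate (λ a∈ eq → absurd (∈-map⁻ suc a∈) eq) ∷ unique-map⁺ sucᶠ-injective (elements-unique p)
  where
  absurd : ∀ {a} → (∃ λ b → b ∈ˡ elements p × a ≡ suc b) → ¬ zero ≡ a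
  absurd (b , _ , refl) ()
elements-unique (false ∷ p) = unique-map⁺ sucᶠ-injective (elements-unique p)

∈-elements⁻ : ∀ {n} (p : Subset n) {a} → a ∈ˡ elements p → a ∈ p
∈-elements⁻ (true  ∷ p) (here refl) = here
∈-elements⁻ (true  ∷ p) (there a∈) with ∈-map⁻ suc a∈
... | b , b∈ , refl = there (∈-elements⁻ p b∈)
∈-elements⁻ (false ∷ p) a∈ with ∈-map⁻ suc a∈
... | b , b∈ , refl = there (∈-elements⁻ p b∈)

length-elements : ∀ {n} (p : Subset n) → length (elements p) ≡ ∣ p ∣
length-elements []          = refl
length-elements (true  ∷ p) = cong suc (trans (length-map suc (elements p)) (length-elements p))
length-elements (false ∷ p) = trans (length-map suc (elements p)) (length-elements p)

avoid : ∀ {n} (i j x : Fin n) → (x ≡ i ⊎ x ≡ j) ⊎ (x ≢ i × x ≢ j)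
avoid i j x with x ≟ᶠ i | x ≟ᶠ j
... | yes e | _      = inj₁ (inj₁ e)
... | no  _ | yes e  = inj₁ (inj₂ e)
... | no  e | no  e′ = inj₂ (e , e′)

third : ∀ {n} (xs : List (Fin n)) → Unique xs → 3 ≤ length xs → ∀ i j → ∃ λ a → a ∈ˡ xs × a ≢ i × a ≢ j
third (_ ∷ [])     _ (s≤s ())
third (_ ∷ _ ∷ []) _ (s≤s (s≤s ()))
third (a ∷ b ∷ c ∷ xs) ((a≢b ∷ a≢c ∷ _) ∷ (b≢c ∷ _) ∷ _) _ i j with avoid i j a | avoid i j b | avoid i j c
... | inj₂ p | _ | _ = a , here refl , p
... | inj₁ _ | inj₂ p | _ = b , there (here refl) , p
... | inj₁ _ | inj₁ _ | inj₂ p = c , there (there (here refl)) , p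
... | inj₁ (inj₁ refl) | inj₁ (inj₁ refl) | _                = ⊥-elim (a≢b refl)
... | inj₁ (inj₂ refl) | inj₁ (inj₂ refl) | _                = ⊥-elim (a≢b refl)
... | inj₁ (inj₁ refl) | inj₁ (inj₂ refl) | inj₁ (inj₁ refl) = ⊥-elim (a≢c refl)
... | inj₁ (inj₁ refl) | inj₁ (inj₂ refl) | inj₁ (inj₂ refl) = ⊥-elim (b≢c refl)
... | inj₁ (inj₂ refl) | inj₁ (inj₁ refl) | inj₁ (inj₁ refl) = ⊥-elim (b≢c refl)
... | inj₁ (inj₂ refl) | inj₁ (inj₁ refl) | inj₁ (inj₂ refl) = ⊥-elim (a≢c refl)

flat : ∀ {A : Set} → List (A × A) → List A
flat []             = []
flat ((a , b) ∷ ps) = a ∷ b ∷ flat ps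

∈-flat : ∀ {A : Set} {a b : A} {ps} → (a , b) ∈ˡ ps → a ∈ˡ flat ps × b ∈ˡ flat ps
∈-flat (here refl) = here refl , there (here refl)
∈-flat (there p∈)  = there (there (proj₁ (∈-flat p∈))) , there (there (proj₂ (∈-flat p∈)))

length-flat : ∀ {A : Set} (ps : List (A × A)) → length (flat ps) ≡ length ps * 2
length-flat []       = refl
length-flat (p ∷ ps) = cong (2 +_) (length-flat ps)

pair-up : ∀ {A : Set} L (xs : List A) → L * 2 ≤ length xs → ∃ λ ps → ∃ λ qs → xs ≡ flat ps ++ qs × length ps ≡ L
pair-up zero    xs           _              = [] , xs , refl , refl
pair-up (suc L) (a ∷ b ∷ xs) (s≤s (s≤s le)) with pair-up L xs le
... | ps , qs , refl , refl = (a , b) ∷ ps , qs , refl , refl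

unique-++⁻ : ∀ {A : Set} (xs : List A) {ys} → Unique (xs ++ ys) →
             Unique xs × Unique ys × (∀ {a} → a ∈ˡ xs → a ∉ˡ ys)
unique-++⁻ []       u        = [] , u , λ ()
unique-++⁻ (x ∷ xs) (x∉ ∷ u) with unique-++⁻ xs u
... | uxs , uys , disjoint = All-++⁻ˡ xs x∉ ∷ uxs , uys , λ
  { (here refl) a∈ → All.lookup (All-++⁻ʳ xs x∉) a∈ refl
  ; (there a∈)     → disjoint a∈ }

Apart : ∀ {A : Set} → A × A → A × A → Set
Apart (a , b) (c , e) = (c ≢ a × c ≢ b) × (e ≢ a × e ≢ b)

pairs-apart : ∀ {A : Set} {ps : List (A × A)} {p p′} → Unique (flat ps) → p ∈ˡ ps → p′ ∈ˡ ps → p ≡ p′ ⊎ Apart p p′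
pairs-apart u (here refl) (here refl) = inj₁ refl
pairs-apart ((_ ∷ a∉) ∷ b∉ ∷ _) (here refl) (there p′∈) = let c∈ , e∈ = ∈-flat p′∈ in
  inj₂ ((All.lookup a∉ c∈ ∘ sym , All.lookup b∉ c∈ ∘ sym) , (All.lookup a∉ e∈ ∘ sym , All.lookup b∉ e∈ ∘ sym))
pairs-apart ((_ ∷ c∉) ∷ e∉ ∷ _) (there p∈) (here refl) = let a∈ , b∈ = ∈-flat p∈ in
  inj₂ ((All.lookup c∉ a∈ , All.lookup c∉ b∈) , (All.lookup e∉ a∈ , All.lookup e∉ b∈))
pairs-apart (_ ∷ _ ∷ u) (there p∈) (there p′∈) = pairs-apart u p∈ p′∈

-- Every pair uses up an element of `R` of its own: by disjointness, removing it from `R` spares the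
-- hits of the other pairs.
pairs≤ : ∀ {n} (ps : List (Fin n × Fin n)) (R : Subset n) → Unique (flat ps) →
         (∀ {a b} → (a , b) ∈ˡ ps → a ∈ R ⊎ b ∈ R) → length ps ≤ ∣ R ∣
pairs≤ []             R _                 _   = z≤n
pairs≤ ((a , b) ∷ ps) R ((_ ∷ a∉) ∷ b∉ ∷ u) hit with hit (here refl)
... | inj₁ a∈R = ≤-trans (s≤s (pairs≤ ps (R - a) u λ p∈ → keep p∈ (hit (there p∈)))) (x∈p⇒∣p-x∣<∣p∣ a∈R)
  where
  keep : ∀ {c e} → (c , e) ∈ˡ ps → c ∈ R ⊎ e ∈ R → c ∈ (R - a) ⊎ e ∈ (R - a)
  keep p∈ (inj₁ c∈R) = inj₁ (x∈p∧x≢y⇒x∈p-y c∈R (All.lookup a∉ (proj₁ (∈-flat p∈)) ∘ sym))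
  keep p∈ (inj₂ e∈R) = inj₂ (x∈p∧x≢y⇒x∈p-y e∈R (All.lookup a∉ (proj₂ (∈-flat p∈)) ∘ sym))
... | inj₂ b∈R = ≤-trans (s≤s (pairs≤ ps (R - b) u λ p∈ → keep p∈ (hit (there p∈)))) (x∈p⇒∣p-x∣<∣p∣ b∈R)
  where
  keep : ∀ {c e} → (c , e) ∈ˡ ps → c ∈ R ⊎ e ∈ R → c ∈ (R - b) ⊎ e ∈ (R - b)
  keep p∈ (inj₁ c∈R) = inj₁ (x∈p∧x≢y⇒x∈p-y c∈R (All.lookup b∉ (proj₁ (∈-flat p∈)) ∘ sym))
  keep p∈ (inj₂ e∈R) = inj₂ (x∈p∧x≢y⇒x∈p-y e∈R (All.lookup b∉ (proj₂ (∈-flat p∈)) ∘ sym))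

-- Some hash function spans

recurs : ∀ {n q m} (w : Vec (𝔽₂^ n) q) (vs : Vec (Vec (𝔽₂^ n) q) m) a b → toℕ a < toℕ b →
         dots w (lookup vs a) ≡ dots w (lookup vs b) → a ∈ recurring w vs
recurs w (u ∷ vs) (suc a) (suc b) (s≤s lt) same = there (recurs w vs a b lt same)
recurs w (u ∷ vs) zero    (suc b) _        same = lookup⇒[]= zero _ (positive (matched vs b same))
  where
  positive : ∀ {m} → 1 ≤ m → (0 <ᵇ m) ≡ true
  positive (s≤s _) = refl
  matched : ∀ {m} (vs : Vec _ m) b → dots w u ≡ dots w (lookup vs b) → 1 ≤ matches w u vs
  matched (v ∷ vs) zero    same = ≤-trans (≤-reflexive (sym (trans (cong (λ z → eqs z (dots w v)) same) (eqs-refl (dots w v))))) (m≤m+n _ _)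
  matched (v ∷ vs) (suc b) same = ≤-trans (matched vs b same) (m≤n+m _ _)

-- Of two positions with equal hashes, the smaller one sees its hash again to the right.
collision : ∀ {n q m} (w : Vec (𝔽₂^ n) q) (vs : Vec (Vec (𝔽₂^ n) q) m) {a b} → a ≢ b →
            dots w (lookup vs a) ≡ dots w (lookup vs b) → a ∈ recurring w vs ⊎ b ∈ recurring w vs
collision w vs {a} {b} a≢b same with <ᶠ-cmp a b
... | tri< lt _ _ = inj₁ (recurs w vs a b lt same)
... | tri≈ _ e _  = ⊥-elim (a≢b e)
... | tri> _ _ gt = inj₂ (recurs w vs b a gt (sym same))

one-or-all : ∀ {n} {ℓ} {A : Fin n → Set} {B : Fin n → Set ℓ} → (∀ i → A i ⊎ B i) → (∀ i → A i) ⊎ ∃ B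
one-or-all {zero}  dec = inj₁ λ ()
one-or-all {suc n} {A = A} {B} dec with dec zero | one-or-all {A = A ∘ suc} {B ∘ suc} (dec ∘ suc)
... | inj₂ b | _            = inj₂ (zero , b)
... | inj₁ a | inj₂ (i , b) = inj₂ (suc i , b)
... | inj₁ a | inj₁ as      = inj₁ λ { zero → a ; (suc i) → as i }

differences : ∀ {n d} → (Fin d → 𝔽₂^ n) → List (Fin d × Fin d) → List (𝔽₂^ n)
differences v = map (λ (a , b) → v a ⊕ v b)

xor-false : ∀ a b → a xor b ≡ false → a ≡ b
xor-false true  true  _ = refl
xor-false false false _ = refl

-- Otherwise each `h` has a non-zero annihilator. Together these form a `w` under which both members
-- of every pair collide, so `recurring w vs` meets all of the disjoint pairs and is too large.
some-hash-spans : ∀ {n q d} (vs : Vec (Vec (𝔽₂^ n) q) d) (ps : List (Fin d × Fin d)) → Unique (flat ps) →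
  (∀ w → VAll NonZeroᵛ w → ∣ recurring w vs ∣ < length ps) →
  ∃ λ h → Spanning (differences (λ i → lookup (lookup vs i) h) ps)
some-hash-spans {n} {q} vs ps unique few
  with one-or-all (λ h → annihilated-or-spanning (differences (λ i → lookup (lookup vs i) h) ps))
... | inj₂ spanning = spanning
... | inj₁ annihilated = ⊥-elim (<⇒≱ (few w (vtabulate⁺ (λ h → proj₁ (proj₂ (annihilated h)))))
    (pairs≤ ps (recurring w vs) unique λ p∈ → collision w vs (distinct unique p∈) (same p∈)))
  where
  w : Vec (𝔽₂^ n) q
  w = tabulate (proj₁ ∘ annihilated)
  distinct : ∀ {ps a b} → Unique (flat ps) → (a , b) ∈ˡ ps → a ≢ b
  distinct ((a≢b ∷ _) ∷ _) (here refl) = a≢b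
  distinct (_ ∷ _ ∷ u)     (there p∈)  = distinct u p∈
  same : ∀ {a b} → (a , b) ∈ˡ ps → dots w (lookup vs a) ≡ dots w (lookup vs b)
  same {a} {b} p∈ = lookup-ext λ h → trans (lookup-zipWith dot h w (lookup vs a))
    (trans (xor-false _ _ (trans (sym (dot-⊕ (lookup w h) _ _))
             (trans (cong (λ z → dot z _) (lookup∘tabulate _ h)) (proj₂ (proj₂ (annihilated h)) (∈-map⁺ _ p∈)))))
           (sym (lookup-zipWith dot h w (lookup vs b))))

-- Moving inside a subcube

agree-refl : ∀ {d} {K : Fin d → Set} {x} → AgreeOff K x x
agree-refl = agreeing λ _ → inj₁ refl

agree-trans : ∀ {d} {K : Fin d → Set} {x y z} → AgreeOff K x y → AgreeOff K y z → AgreeOff K x z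
agree-trans {K = K} {x} {y} {z} (agreeing xy) (agreeing yz) = agreeing xz
  where
  xz : ∀ b → lookup x b ≡ lookup z b ⊎ K b
  xz b with xy b | yz b
  ... | inj₁ e | inj₁ e′ = inj₁ (trans e e′)
  ... | inj₁ _ | inj₂ k  = inj₂ k
  ... | inj₂ k | _       = inj₂ k

agree-mono : ∀ {d} {K K′ : Fin d → Set} {x y} → (∀ {b} → K b → K′ b) → AgreeOff K x y → AgreeOff K′ x y
agree-mono K⊆K′ (agreeing xy) = agreeing λ b → Sum.map₂ K⊆K′ (xy b)

agree-lookup : ∀ {d} {K : Fin d → Set} {x y b} → AgreeOff K x y → ¬ K b → lookup y b ≡ lookup x b
agree-lookup {b = b} (agreeing xy) ¬k with xy b
... | inj₁ e = sym e
... | inj₂ k = ⊥-elim (¬k k)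

agree-flip : ∀ {d} {K : Fin d → Set} (x : Vertex d) a → K a → AgreeOff K x (flip x a)
agree-flip {K = K} x a k = agreeing xy
  where
  xy : ∀ b → lookup x b ≡ lookup (flip x a) b ⊎ K b
  xy b with b ≟ᶠ a
  ... | yes refl = inj₂ k
  ... | no  b≢a  = inj₁ (sym (lookup-flip′ x b≢a))

Balanced : ∀ {d} → Vertex d → List (Fin d × Fin d) → Set
Balanced x ps = ∀ {a b} → (a , b) ∈ˡ ps → lookup x a ≢ lookup x b

balance : ∀ {d} (ps : List (Fin d × Fin d)) → Unique (flat ps) → ∀ x →
          ∃ λ y → AgreeOff (_∈ˡ flat ps) x y × Balanced y ps
balance []             _                      x = x , agree-refl , λ ()
balance ((a , b) ∷ ps) ((a≢b ∷ a∉) ∷ b∉ ∷ u) x with balance ps u x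
... | y , agree , bal with lookup y a Bool.≟ lookup y b
... | no ya≢yb = y , agree-mono (λ k → there (there k)) agree , λ { (here refl) → ya≢yb ; (there p∈) → bal p∈ }
... | yes ya≡yb = flip y a
    , agree-trans (agree-mono (λ k → there (there k)) agree) (agree-flip y a (here refl))
    , λ { (here refl) eq → not-¬ {lookup y a} refl
                             (trans ya≡yb (trans (sym (lookup-flip′ y (a≢b ∘ sym))) (trans (sym eq) (lookup-flip y a))))
        ; (there p∈) eq → bal p∈ (trans (sym (lookup-flip′ y (All.lookup a∉ (proj₁ (∈-flat p∈)) ∘ sym)))
                            (trans eq (lookup-flip′ y (All.lookup a∉ (proj₂ (∈-flat p∈)) ∘ sym)))) }

Clear : ∀ {d} → Vertex d → List (Fin d) → Set
Clear x qs = ∀ {a} → a ∈ˡ qs → lookup x a ≡ false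

clear : ∀ {d} (qs : List (Fin d)) x → ∃ λ y → AgreeOff (_∈ˡ qs) x y × Clear y qs
clear []       x = x , agree-refl , λ ()
clear (a ∷ qs) x with clear qs x
... | y , agree , clr with lookup y a in ya
... | false = y , agree-mono there agree , λ { (here refl) → ya ; (there c∈) → clr c∈ }
... | true  = flip y a , agree-trans (agree-mono there agree) (agree-flip y a (here refl)) , λ
  { (here refl) → trans (lookup-flip y a) (cong not ya)
  ; (there c∈)  → trans (lookup-flip′ y (λ { refl → contra (trans (sym ya) (clr c∈)) })) (clr c∈) }
  where
  contra : ¬ true ≡ false
  contra ()

raise : ∀ {d} u (qs : List (Fin d)) → Unique qs → ∀ x → Clear x qs → u ≤ length qs →
        ∃ λ y → AgreeOff (_∈ˡ qs) x y × wt y ≡ u + wt x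
raise zero    qs       _        x clr _        = x , agree-refl , refl
raise (suc u) (a ∷ qs) (a∉ ∷ u!) x clr (s≤s le)
  with raise u qs u! (flip x a) (λ c∈ → trans (lookup-flip′ x (All.lookup a∉ c∈ ∘ sym)) (clr (there c∈))) le
... | y , agree , weight = y , agree-trans (agree-flip x a (here refl)) (agree-mono there agree)
    , trans weight (trans (cong (u +_) up) (+-suc u (wt x)))
  where
  up : wt (flip x a) ≡ suc (wt x)
  up with lookup x a | clr (here refl) | wt-flip x a
  ... | false | refl | eq = trans (sym (+-identityʳ _)) (trans eq (+-comm (wt x) 1))

flip₂ : ∀ {d} → Vertex d → Fin d → Fin d → Vertex d
flip₂ y a b = flip (flip y a) b

wt-flip₂ : ∀ {d} (y : Vertex d) {a b} → lookup y a ≢ lookup y b → wt (flip₂ y a b) ≡ wt y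
wt-flip₂ y {a} {b} ya≢yb = +-cancelʳ-≡ (ι (lookup y b)) _ _ (begin
  wt (flip₂ y a b) + ι (lookup y b)                   ≡⟨ cong (λ z → wt (flip₂ y a b) + ι z) (sym untouched) ⟩
  wt (flip₂ y a b) + ι (lookup (flip y a) b)          ≡⟨ wt-flip (flip y a) b ⟩
  wt (flip y a) + ι (not (lookup (flip y a) b))       ≡⟨ cong (λ z → wt (flip y a) + ι z) (trans (cong not untouched) (sym (¬-not ya≢yb))) ⟩
  wt (flip y a) + ι (lookup y a)                      ≡⟨ wt-flip y a ⟩
  wt y + ι (not (lookup y a))                         ≡⟨ cong (λ z → wt y + ι z) (sym (¬-not (ya≢yb ∘ sym))) ⟩
  wt y + ι (lookup y b)                               ∎)
  where
  open ≡-Reasoning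
  untouched : lookup (flip y a) b ≡ lookup y b
  untouched = lookup-flip′ y (λ b≡a → ya≢yb (cong (lookup y) (sym b≡a)))

lookup-flip₂ : ∀ {d} (y : Vertex d) {a b c} → c ≢ a → c ≢ b → lookup (flip₂ y a b) c ≡ lookup y c
lookup-flip₂ y c≢a c≢b = trans (lookup-flip′ (flip y _) c≢b) (lookup-flip′ y c≢a)

balanced-flip₂ : ∀ {d} {ps : List (Fin d × Fin d)} → Unique (flat ps) → ∀ y {a b} → (a , b) ∈ˡ ps →
                 Balanced y ps → Balanced (flip₂ y a b) ps
balanced-flip₂ u y {a} {b} p∈ bal {c} {e} p′∈ eq with pairs-apart u p∈ p′∈
... | inj₂ ((c≢a , c≢b) , (e≢a , e≢b)) = bal p′∈ (trans (sym (lookup-flip₂ y c≢a c≢b)) (trans eq (lookup-flip₂ y e≢a e≢b)))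
... | inj₁ refl = bal p∈ (not-injective (begin
  not (lookup y a)           ≡⟨ sym (lookup-flip y a) ⟩
  lookup (flip y a) a        ≡⟨ sym (lookup-flip′ (flip y a) a≢b) ⟩
  lookup (flip₂ y a b) a     ≡⟨ eq ⟩
  lookup (flip₂ y a b) b     ≡⟨ lookup-flip (flip y a) b ⟩
  not (lookup (flip y a) b)  ≡⟨ cong not (lookup-flip′ y (a≢b ∘ sym)) ⟩
  not (lookup y b)           ∎))
  where
  open ≡-Reasoning
  a≢b : a ≢ b
  a≢b refl = bal p∈ refl

-- `Spanning` is applied to the syndromes reachable at constant weight; balance belongs to the
-- predicate because the next flip of a pair relies on it.
steer : ∀ {d n} (v : Fin d → 𝔽₂^ n) (ps : List (Fin d × Fin d)) → Unique (flat ps) → Spanning (differences v ps) →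
        ∀ x → Balanced x ps → ∀ s → ∃ λ y → AgreeOff (_∈ˡ flat ps) x y × wt y ≡ wt x × syn v y ≡ s
steer {d} {n} v ps u spans x bal s =
  let y , agree , weight , _ , synd = spans P step (syn v x) s (x , agree-refl , refl , bal , refl)
  in y , agree , weight , synd
  where
  P : 𝔽₂^ n → Set
  P s = ∃ λ y → AgreeOff (_∈ˡ flat ps) x y × wt y ≡ wt x × Balanced y ps × syn v y ≡ s
  step : ∀ s {t} → t ∈ˡ differences v ps → P s → P (s ⊕ t)
  step s t∈ (y , agree , weight , bal , refl) with ∈-map⁻ (λ (a , b) → v a ⊕ v b) t∈
  ... | (a , b) , p∈ , refl = flip₂ y a b
    , agree-trans agree (agree-trans (agree-flip y a (proj₁ (∈-flat p∈))) (agree-flip (flip y a) b (proj₂ (∈-flat p∈))))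
    , trans (wt-flip₂ y (bal p∈)) weight
    , balanced-flip₂ u y p∈ bal
    , trans (syn-flip v (flip y a) b) (trans (cong (_⊕ v b) (syn-flip v y a)) (⊕-assoc (syn v y) (v a) (v b)))

-- The window of `q` consecutive values slides by one; a `t` that drops out at the lower end
-- re-enters as `m + q`.
residue : ∀ q .{{_ : NonZero q}} m (h : Fin q) → ∃ λ t → m ≤ t × t < m + q × t mod q ≡ h
residue q zero    h = toℕ h , z≤n , toℕ<n h , toℕ-injective (trans (toℕ-fromℕ< _) (m<n⇒m%n≡m (toℕ<n h)))
residue q (suc m) h with residue q m h
... | t , m≤t , t<m+q , eq with m ≟ t
... | no  m≢t  = t , ≤∧≢⇒< m≤t m≢t , m≤n⇒m≤1+n t<m+q , eq
... | yes refl = m + q , m<m+n m (>-nonZero⁻¹ q) , n<1+n _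
    , toℕ-injective (trans (toℕ-fromℕ< _) (trans ([m+n]%n≡m%n m q) (trans (sym (toℕ-fromℕ< _)) (cong toℕ eq))))

-- Among `q` consecutive levels one has the required residue. Starting at `suc (W / 4)` puts 4t at
-- or above `W`, while the weight to be added stays within `4 * q + 2`.
level : ∀ q .{{_ : NonZero q}} (h : Fin q) W e → e ≤ 2 → ∃ λ t → t mod q ≡ h × ∃ λ u → u ≤ 4 * q + 2 × 4 * t + e ≡ u + W
level q h W e e≤2 with residue q (suc (W / 4)) h
... | t , lo , hi , eq = t , eq , 4 * t + e ∸ W
    , ≤-trans (∸-monoˡ-≤ W top) (≤-reflexive (m+n∸n≡m (4 * q + 2) W))
    , sym (m∸n+n≡m bottom)
  where
  open ≤-Reasoning
  bottom : W ≤ 4 * t + e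
  bottom = begin
    W                     ≡⟨ m≡m%n+[m/n]*n W 4 ⟩
    W % 4 + W / 4 * 4     ≤⟨ +-monoˡ-≤ (W / 4 * 4) (<⇒≤ (m%n<n W 4)) ⟩
    4 + W / 4 * 4         ≡⟨ *-comm (suc (W / 4)) 4 ⟩
    4 * suc (W / 4)       ≤⟨ *-monoʳ-≤ 4 lo ⟩
    4 * t                 ≤⟨ m≤m+n _ e ⟩
    4 * t + e             ∎
  expand : ∀ m q → 4 * (m + q) + 2 ≡ 4 * q + 2 + m * 4
  expand = solve-∀
  top : 4 * t + e ≤ 4 * q + 2 + W
  top = begin
    4 * t + e                          ≤⟨ +-mono-≤ (*-monoʳ-≤ 4 (s≤s⁻¹ hi)) e≤2 ⟩
    4 * (W / 4 + q) + 2                ≡⟨ expand (W / 4) q ⟩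
    4 * q + 2 + W / 4 * 4              ≤⟨ +-monoʳ-≤ (4 * q + 2) (m≤n+m _ (W % 4)) ⟩
    4 * q + 2 + (W % 4 + W / 4 * 4)    ≡⟨ cong (4 * q + 2 +_) (sym (m≡m%n+[m/n]*n W 4)) ⟩
    4 * q + 2 + W                      ∎

-- Connectedness from spanning hashes

module Family {d n q : ℕ} .{{_ : NonZero q}} (hash : Fin q → Fin d → 𝔽₂^ n)
              (code : Fin q → Fin d → Fin d → 𝔽₂^ n) (separated : ∀ h → Separated (hash h) (code h)) where

  -- The hashes are periodic in the level, so any `q` consecutive levels show all of them.
  open Cells (λ t → hash (t mod q)) (λ t → code (t mod q)) (λ t → separated (t mod q))
  open Swaps swaps public using (Swapped; M; M-factorisation; connected)

  -- `i` is the colour that crosses in a cell, the pairs `ps` steer the syndrome, and `qs` supplies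
  -- weight.
  module _ {i : Fin d} {ps : List (Fin d × Fin d)} {qs : List (Fin d)}
           (unique : Unique (i ∷ flat ps ++ qs)) (enough : 4 * q + 2 ≤ length qs)
           (rich : ∃ λ h → Spanning (differences (hash h) ps)) where

    private
      i∉ : i ∉ˡ flat ps ++ qs
      i∉ i∈ = All.lookup (AllPairs.head unique) i∈ refl
      tail! : Unique (flat ps ++ qs)
      tail! = AllPairs.tail unique
      ps! : Unique (flat ps)
      ps! = proj₁ (unique-++⁻ (flat ps) tail!)
      qs! : Unique qs
      qs! = proj₁ (proj₂ (unique-++⁻ (flat ps) tail!))
      disjoint : ∀ {a} → a ∈ˡ flat ps → a ∉ˡ qs
      disjoint = proj₂ (proj₂ (unique-++⁻ (flat ps) tail!))
      kept : ∀ {y z a} → AgreeOff (_∈ˡ qs) y z → a ∈ˡ flat ps → lookup z a ≡ lookup y a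
      kept yz a∈ = agree-lookup yz (disjoint a∈)
      In : Fin d → Set
      In = _∈ˡ flat ps ++ qs

    -- The target is expressed through the bits of `x`, known before `y` is built; `y` has the same
    -- bits at `i` and `j`, which lie outside `In`.
    aim : ∀ x i j t → (∃ λ y → AgreeOff In x y × wt y ≡ 4 * t + (ι (lookup x i) + ι (lookup x j)) ×
            syn (hash (t mod q)) y ≡ code (t mod q) i j ⊕ (lookup x i ∙ hash (t mod q) i ⊕ lookup x j ∙ hash (t mod q) j)) →
          ¬ In i → ¬ In j → j ≢ i → ∃ λ y → AgreeOff In x y × Cell y i j
    aim x i j t (y , agree , weight , syndrome) i∉ j∉ j≢i = y , agree , (j≢i ∘ sym) , t , on-cycle
      where
      on-cycle : OnCycle t (code (t mod q) i j) y i j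
      on-cycle rewrite sym (agree-lookup agree i∉) | sym (agree-lookup agree j∉) = onCycle weight syndrome

    -- The order keeps earlier gains: clearing and raising touch only `qs` and so preserve balance,
    -- and steering preserves the weight.
    hits-cell : ∀ x j → j ≢ i → ¬ In j → ∃ λ y → AgreeOff In x y × Cell y i j
    hits-cell x j j≢i j∉ =
      let h , spans = rich
          x₁ , agree₁ , balanced = balance ps ps! x
          x₂ , agree₂ , clr = clear qs x₁
          t , t≡h , u , u≤ , target = level q h (wt x₂) (ι (lookup x i) + ι (lookup x j))
                                        (+-mono-≤ (ι≤1 (lookup x i)) (ι≤1 (lookup x j)))
          x₃ , agree₃ , raised = raise u qs qs! x₂ clr (≤-trans u≤ enough)
          agree₂₃ = agree-trans agree₂ agree₃
          y , agree₄ , same , synd =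
            steer (hash (t mod q)) ps ps! (subst (λ h → Spanning (differences (hash h) ps)) (sym t≡h) spans) x₃
              (λ p∈ eq → balanced p∈ (trans (sym (kept agree₂₃ (proj₁ (∈-flat p∈))))
                                       (trans eq (kept agree₂₃ (proj₂ (∈-flat p∈))))))
              (code (t mod q) i j ⊕ (lookup x i ∙ hash (t mod q) i ⊕ lookup x j ∙ hash (t mod q) j))
          agree = agree-trans (agree-mono ∈-++⁺ˡ agree₁)
                    (agree-trans (agree-mono (∈-++⁺ʳ (flat ps)) agree₂₃) (agree-mono ∈-++⁺ˡ agree₄))
      in aim x i j t (y , agree , trans same (trans raised (sym target)) , synd) i∉ j∉ j≢i

  -- The bound on `∣ N ∣` pays for one crossing colour, `L` pairs and `4 * q + 2` directions that
  -- supply weight.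
  unions-connected : ∀ L → 2 ≤ L →
                     (∀ ps → length ps ≡ L → Unique (flat ps) → ∃ λ h → Spanning (differences (hash h) ps)) →
                     ∀ N → suc (L * 2 + (4 * q + 2)) ≤ ∣ N ∣ → Connected (UnionEdges M N)
  unions-connected L 2≤L rich N large = connected N spare (hits (elements N) refl)
    where
    long : suc (L * 2 + (4 * q + 2)) ≤ length (elements N)
    long = ≤-trans large (≤-reflexive (sym (length-elements N)))
    spare : ∀ i j → ∃ λ a → a ∈ N × a ≢ i × a ≢ j
    spare i j with third (elements N) (elements-unique N)
                     (≤-trans (s≤s (≤-trans (≤-trans 2≤L (m≤m*n L 2)) (m≤m+n _ _))) long) i j
    ... | a , a∈ , a≢i , a≢j = a , ∈-elements⁻ N a∈ , a≢i , a≢j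
    Hit : Vertex d → Fin d → Set
    Hit x j = ∃ λ y → ∃ λ i → AgreeOff (_∈ N) x y × i ∈ N × Swapped y i j
    hit : ∀ {i ps qs} → elements N ≡ i ∷ flat ps ++ qs → length ps ≡ L → ∀ x j → j ∉ N → Hit x j
    hit {i} {ps} {qs} eq refl x j j∉N =
      let y , agree , cell = hits-cell {i} {ps} {qs} unique enough
                               (rich ps refl (proj₁ (unique-++⁻ (flat ps) (AllPairs.tail unique)))) x j
                               (λ { refl → j∉N (inside (here refl)) }) (λ j∈ → j∉N (inside (there j∈)))
      in y , i , agree-mono (λ b∈ → inside (there b∈)) agree , inside (here refl) , inj₁ cell
      where
      inside : ∀ {a} → a ∈ˡ i ∷ flat ps ++ qs → a ∈ N
      inside a∈ = ∈-elements⁻ N (subst (_ ∈ˡ_) (sym eq) a∈)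
      unique : Unique (i ∷ flat ps ++ qs)
      unique = subst Unique eq (elements-unique N)
      enough : 4 * q + 2 ≤ length qs
      enough = +-cancelˡ-≤ (length ps * 2) _ _
        (≤-trans (s≤s⁻¹ (subst (λ zs → suc (length ps * 2 + (4 * q + 2)) ≤ length zs) eq long))
          (≤-reflexive (trans (length-++ (flat ps)) (cong (_+ length qs) (length-flat ps)))))
    hits : ∀ xs → elements N ≡ xs → ∀ x j → j ∉ N → Hit x j
    hits []       eq = ⊥-elim (<⇒≱ (s≤s z≤n) (subst (λ zs → suc (L * 2 + (4 * q + 2)) ≤ length zs) eq long))
    hits (i ∷ xs) eq
      with ps , qs , refl , L≡ ← pair-up L xs (≤-trans (m≤m+n _ _)
             (s≤s⁻¹ (subst (λ zs → suc (L * 2 + (4 * q + 2)) ≤ length zs) eq long))) = hit {i} {ps} {qs} eq L≡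

-- Choice of the parameters

log₂ : ∀ d → 1 ≤ d → ∃ λ κ → 2 ^ κ ≤ d × d < 2 ^ suc κ
log₂ (suc zero)    _ = 0 , s≤s z≤n , s≤s (s≤s z≤n)
log₂ (suc (suc d)) _ with log₂ (suc d) (s≤s z≤n)
... | κ , lo , hi with suc (suc d) <? 2 ^ suc κ
... | yes lt = κ , m≤n⇒m≤1+n lo , lt
... | no ¬lt = suc κ , ≮⇒≥ ¬lt , ≤-<-trans hi (^-monoʳ-< 2 (s≤s (s≤s z≤n)) (n<1+n (suc κ)))

-- The factor 32 of `separated-code` lies strictly below `2 ^ 6`, whence syndromes of length
-- `3 * k + 6`.
codes-fit : ∀ d k → d ≤ 2 ^ k → d * d * (32 * d) < 2 ^ (3 * k + 6)
codes-fit d k d≤D = begin-strict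
  d * d * (32 * d)      ≤⟨ *-mono-≤ (*-mono-≤ d≤D d≤D) (*-monoʳ-≤ 32 d≤D) ⟩
  D * D * (32 * D)      ≡⟨ cube D ⟩
  D * D * D * 32        <⟨ *-monoʳ-< (D * D * D) {{m*n≢0 (D * D) D {{m*n≢0 D D}}}} (≤ᵇ⇒≤ 33 64 _) ⟩
  D * D * D * 64        ≡⟨ cong (_* 64) (sym (trans (cong (2 ^_) (triple k)) (trans (^-distribˡ-+-* 2 (k + k) k) (cong (_* D) (^-distribˡ-+-* 2 k k))))) ⟩
  2 ^ (3 * k) * 64      ≡⟨ sym (^-distribˡ-+-* 2 (3 * k) 6) ⟩
  2 ^ (3 * k + 6)       ∎
  where
  open ≤-Reasoning
  D = 2 ^ k
  instance
    D≢0 : NonZero D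
    D≢0 = m^n≢0 2 k
  cube : ∀ D → D * D * (32 * D) ≡ D * D * D * 32
  cube = solve-∀
  triple : ∀ k → 3 * k ≡ k + k + k
  triple = solve-∀

theorem1p2 : ∀ (d : ℕ) → 3000 ≤ d →
    Σ (Fin d → EdgeSet d) λ M →
    IsOneFactorisation M ×
    (∀ (N : Subset d) → d ^ 45 ≤ 2 ^ ∣ N ∣ → Connected (UnionEdges M N))
theorem1p2 d 3000≤d = M , M-factorisation , λ N large →
  unions-connected L (m≤n⇒m≤o+n (9 * k) (≤ᵇ⇒≤ 2 29 _)) rich N (enough ∣ N ∣ (many N large))
  where
  logarithm = log₂ d (≤-trans (≤ᵇ⇒≤ 1 3000 _) 3000≤d)
  -- `κ` rounds log₂ d down, for the lower bound on `∣ N ∣`; `k` bounds it from above, for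
  -- `d ≤ 2 ^ k`.
  κ k L : ℕ
  κ = proj₁ logarithm
  k = suc κ
  -- With n = 3k + 6 and q = 3k + 1, the product kL = 9k² + 29k exceeds nq + 1 = 9k² + 21k + 7 for
  -- every k ≥ 1, as `few` requires.
  L = 9 * k + 29
  d≤2^k : d ≤ 2 ^ k
  d≤2^k = <⇒≤ (proj₂ (proj₂ logarithm))
  hashing = few-recurring (3 * k + 6) k d d≤2^k
  instance
    q≢0 : NonZero (3 * k + 1)
    q≢0 = subst NonZero (+-comm 1 (3 * k)) nonZero
  hash : Fin (3 * k + 1) → Fin d → 𝔽₂^ (3 * k + 6)
  hash h i = lookup (lookup (proj₁ hashing) i) h
  codes : ∀ h → ∃ (Separated (hash h))
  codes h = separated-code (hash h) (codes-fit d k d≤2^k)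
  open Family hash (proj₁ ∘ codes) (proj₂ ∘ codes)
  few : ∀ w → VAll NonZeroᵛ w → ∣ recurring w (proj₁ hashing) ∣ < L
  few w nz = ≰⇒> λ L≤R → <⇒≱ (≤-trans (m≤m+n _ (8 * κ)) (≤-reflexive (sym (gap κ))))
                              (≤-trans (*-monoʳ-≤ k L≤R) (proj₂ hashing w nz))
    where
    gap : ∀ κ → suc κ * (9 * suc κ + 29) ≡ suc ((3 * suc κ + 6) * (3 * suc κ + 1) + 1) + 8 * κ
    gap = solve-∀
  rich : ∀ ps → length ps ≡ L → Unique (flat ps) → ∃ λ h → Spanning (differences (hash h) ps)
  rich ps ∣ps∣≡L unique = some-hash-spans (proj₁ hashing) ps unique
    (λ w nz → subst (∣ recurring w (proj₁ hashing) ∣ <_) (sym ∣ps∣≡L) (few w nz))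
  -- Obtained from 2⁸ ≤ d; from κ = 7 on, 45κ covers the 30κ + 95 directions demanded by
  -- `unions-connected`.
  7≤κ : 7 ≤ κ
  7≤κ = s≤s⁻¹ (<⇒≤ (^-cancel-< {8} (≤-<-trans (≤-trans (≤ᵇ⇒≤ 256 3000 _) 3000≤d) (proj₂ (proj₂ logarithm)))))
  -- The hypothesis is `∣ N ∣` ≥ 45 log₂ d in exponential form; inserting `2 ^ κ ≤ d` gives 45κ.
  many : ∀ N → d ^ 45 ≤ 2 ^ ∣ N ∣ → κ * 45 ≤ ∣ N ∣
  many N large = ^-cancel-≤ (≤-trans (≤-reflexive (sym (^-*-assoc 2 κ 45)))
                              (≤-trans (^-monoˡ-≤ 45 (proj₁ (proj₂ logarithm))) large))
  enough : ∀ r → κ * 45 ≤ r → suc (L * 2 + (4 * (3 * k + 1) + 2)) ≤ r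
  enough r 45κ≤r = ≤-trans (budget κ 7≤κ) 45κ≤r
    where
    expand : ∀ m → (7 + m) * 45 ≡
             suc ((9 * suc (7 + m) + 29) * 2 + (4 * (3 * suc (7 + m) + 1) + 2)) + (10 + 15 * m)
    expand = solve-∀
    budget : ∀ κ → 7 ≤ κ → suc ((9 * suc κ + 29) * 2 + (4 * (3 * suc κ + 1) + 2)) ≤ κ * 45
    budget κ 7≤κ with m≤n⇒∃[o]m+o≡n 7≤κ
    ... | m , refl = ≤-trans (m≤m+n _ _) (≤-reflexive (sym (expand m)))
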